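{- Let $G$ be a finite undirected multigraph without loops on $n$ vertices. Let $\Delta$ be its maximal edge multiplicity, and assume $\Delta \geqslant 1$. Let $d_1 \leqslant \dots \leqslant d_n$ be its degree sequence, and let $\tau(G)$ be the number of spanning trees of $G$. Then the inequality $$\tau(G) \leqslant \frac{(\Delta+d_1)(\Delta+d_2)\cdots(\Delta+d_n)}{\Delta\, n^2}$$ turns into an equality if and only if $G$ is a complete multigraph with all edge multiplicities equal to $\Delta$, i.e. every two distinct vertices of $G$ are joined by exactly $\Delta$ edges.
   Context: In a multigraph, two distinct vertices may be joined by several (parallel, distinguishable) edges; the multiplicity of a pair of distinct vertices is the number of edges joining them. The maximal edge multiplicity $\Delta$ is the maximum of these multiplicities over all pairs of distinct vertices. The degree of a vertex is the number of edges incident to it, counted with multiplicity. $\tau(G)$ counts spanning trees with parallel edges regarded as distinct, i.e. it is the number of sets of edges of $G$ that form a tree on all vertices of $G$. The displayed inequality holds for every such $G$. -}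

module Defs where

open import Data.Fin using (Fin; zero; suc; _≟_)
open import Data.Fin.Properties using (all?; any?; injective⇒≤)
open import Data.Fin.Subset using (Subset; inside; outside; _∈_)
open import Data.Fin.Subset.Properties using (_∈?_)
open import Data.Integer using (+_)
open import Data.List
  using (List; []; _∷_; [_]; _++_; map; length; filter; lookup;
         allFin; cartesianProduct)
open import Data.List.Extrema.Nat using (max)
import Data.List.Membership.Propositional as L
import Data.List.Membership.DecPropositional as DecL
open import Data.List.Membership.Propositional.Properties using (∈-lookup)
open import Data.List.Relation.Unary.All as All using (All; []; _∷_)
open import Data.List.Relation.Unary.All.Properties using (¬Any⇒All¬)
open import Data.List.Relation.Unary.AllPairs using ([]; _∷_)
open import Data.List.Relation.Unary.Any using (here; there)
open import Data.List.Relation.Unary.Unique.Propositional using (Unique)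
import Data.List.Relation.Unary.Unique.DecPropositional as DecUnique
open import Data.Nat using (ℕ; zero; suc; _+_; _*_; _^_; _≤_; _<_; s≤s; NonZero; >-nonZero)
open import Data.Nat.ListAction using (product)
open import Data.Nat.Properties using (≤-decTotalOrder; suc-injective; anyUpTo?; m*n≢0; m^n≢0)
open import Data.Product using (Σ; _×_; _,_; proj₁; proj₂)
open import Data.Product.Properties using (≡-dec)
open import Data.Rational using (ℚ; _/_)
open import Data.Sum using (_⊎_)
open import Data.Vec using ([]; _∷_)
open import Relation.Binary.PropositionalEquality
  using (_≡_; _≢_; refl; sym; cong)
open import Relation.Nullary using (¬_; Dec; yes; no; ¬?; contradiction)
open import Relation.Nullary.Decidable using (map′; _×-dec_; _⊎-dec_)
open import Data.List.Sort ≤-decTotalOrder using (sort)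

-- Edges are individual, labelled objects, so parallel edges are distinct.
-- The order of the two ends of an edge carries no meaning: everything below
-- goes through Joins or Incident, which are symmetric in the two ends.
record Multigraph (n : ℕ) : Set where
  field
    size     : ℕ
    ends     : Fin size → Fin n × Fin n
    loopless : ∀ e → proj₁ (ends e) ≢ proj₂ (ends e)

module _ {n : ℕ} (G : Multigraph n) where
  open Multigraph G

  Joins : Fin size → Fin n → Fin n → Set
  Joins e u v = ends e ≡ (u , v) ⊎ ends e ≡ (v , u)

  Incident : Fin n → Fin size → Set
  Incident v e = proj₁ (ends e) ≡ v ⊎ proj₂ (ends e) ≡ v

  joins? : ∀ e u v → Dec (Joins e u v)
  joins? e u v = ≡-dec _≟_ _≟_ (ends e) (u , v) ⊎-dec ≡-dec _≟_ _≟_ (ends e) (v , u)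

  incident? : ∀ v e → Dec (Incident v e)
  incident? v e = (proj₁ (ends e) ≟ v) ⊎-dec (proj₂ (ends e) ≟ v)

  multiplicity : Fin n → Fin n → ℕ
  multiplicity u v = length (filter (λ e → joins? e u v) (allFin size))

  degree : Fin n → ℕ
  degree v = length (filter (incident? v) (allFin size))

  degreeSequence : List ℕ
  degreeSequence = sort (map degree (allFin n))

  distinctPairs : List (Fin n × Fin n)
  distinctPairs =
    filter (λ (u , v) → ¬? (u ≟ v)) (cartesianProduct (allFin n) (allFin n))

  -- Equal to 0 when n ≤ 1, where there are no pairs of distinct vertices.
  maxMultiplicity : ℕ
  maxMultiplicity = max 0 (map (λ (u , v) → multiplicity u v) distinctPairs)

  IsCompleteMultigraph : Set
  IsCompleteMultigraph = ∀ u v → u ≢ v → multiplicity u v ≡ maxMultiplicity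

  module _ (S : Subset size) where

    data Walk : Fin n → Fin n → Set where
      []   : ∀ {u} → Walk u u
      step : ∀ {u v w} (e : Fin size) → e ∈ S → Joins e u v → Walk v w → Walk u w

    edges : ∀ {u v} → Walk u v → List (Fin size)
    edges []             = []
    edges (step e _ _ p) = e ∷ edges p

    -- All vertices visited except the final one, so that on a closed walk
    -- the common start and end is listed once.
    initVertices : ∀ {u v} → Walk u v → List (Fin n)
    initVertices []                     = []
    initVertices (step {u = u} _ _ _ p) = u ∷ initVertices p

    -- Two parallel edges form a cycle of length 2.
    IsCycle : ∀ {u} → Walk u u → Set
    IsCycle p = edges p ≢ [] × Unique (edges p) × Unique (initVertices p)

    Connected : Set
    Connected = ∀ u v → Walk u v

    Acyclic : Set
    Acyclic = ∀ u (p : Walk u u) → ¬ IsCycle p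

    IsSpanningTree : Set
    IsSpanningTree = Connected × Acyclic

-- Decidability of IsSpanningTree: only walks of bounded length need to be
-- searched, since a list of distinct elements of Fin m has length at most m.

lookup-unique : ∀ {m} {xs : List (Fin m)} → Unique xs →
                ∀ {i j} → lookup xs i ≡ lookup xs j → i ≡ j
lookup-unique (_   ∷ _)  {zero}  {zero}  _  = refl
lookup-unique (x∉  ∷ _)  {zero}  {suc j} eq = contradiction eq (All.lookup x∉ (∈-lookup j))
lookup-unique (x∉  ∷ _)  {suc i} {zero}  eq = contradiction (sym eq) (All.lookup x∉ (∈-lookup i))
lookup-unique (_   ∷ us) {suc i} {suc j} eq = cong suc (lookup-unique us eq)

unique-length : ∀ {m} {xs : List (Fin m)} → Unique xs → length xs < suc m
unique-length us = s≤s (injective⇒≤ (lookup-unique us))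

module _ {n : ℕ} (G : Multigraph n) (S : Subset (Multigraph.size G)) where
  open Multigraph G

  WalkSatisfying : (List (Fin size) → List (Fin n) → Set) → ℕ → Fin n → Fin n → Set
  WalkSatisfying P k u w =
    Σ (Walk G S u w) λ p → length (edges G S p) ≡ k × P (edges G S p) (initVertices G S p)

  walkSatisfying? : (P : List (Fin size) → List (Fin n) → Set) → (∀ es vs → Dec (P es vs)) →
                    ∀ k u w → Dec (WalkSatisfying P k u w)
  walkSatisfying? P P? zero u w =
    map′ (λ { (refl , r) → [] , refl , r }) (λ { ([] , _ , r) → refl , r })
         ((u ≟ w) ×-dec P? [] [])
  walkSatisfying? P P? (suc k) u w =
    map′ (λ { (e , v , e∈S , j , p , l , r) → step e e∈S j p , cong suc l , r })
         (λ { (step e e∈S j p , l , r) → e , _ , e∈S , j , p , suc-injective l , r })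
         (any? λ e → any? λ v → (e ∈? S) ×-dec joins? G e u v ×-dec
            walkSatisfying? (λ es vs → P (e ∷ es) (u ∷ vs))
                            (λ es vs → P? (e ∷ es) (u ∷ vs)) k v w)

  Cycle : Fin n → Set
  Cycle u = Σ (Walk G S u u) (IsCycle G S)

  cycle? : ∀ u → Dec (Cycle u)
  cycle? u =
    map′ (λ { (_ , _ , p , _ , c) → p , c })
         (λ { (p , c@(_ , us , _)) → _ , unique-length us , p , refl , c })
         (anyUpTo? (λ k → walkSatisfying? IsC isC? k u u) (suc size))
    where
    IsC : List (Fin size) → List (Fin n) → Set
    IsC es vs = es ≢ [] × Unique es × Unique vs

    nonempty? : (es : List (Fin size)) → Dec (es ≢ [])
    nonempty? []      = no λ ne → ne refl
    nonempty? (_ ∷ _) = yes λ ()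

    isC? : ∀ es vs → Dec (IsC es vs)
    isC? es vs = nonempty? es ×-dec DecUnique.unique? _≟_ es ×-dec DecUnique.unique? _≟_ vs

  acyclic? : Dec (Acyclic G S)
  acyclic? = map′ (λ h u p c → h u (p , c)) (λ h u (p , c) → h u p c)
                  (all? λ u → ¬? (cycle? u))

  Path : Fin n → Fin n → Set
  Path u w = Σ (Walk G S u w) λ p → Unique (initVertices G S p)

  dropUntil : ∀ {u v w} ((p , _) : Path v w) → u L.∈ initVertices G S p → Path u w
  dropUntil (p@(step _ _ _ _) , us)     (here refl) = p , us
  dropUntil (step _ _ _ p     , _ ∷ us) (there u∈p) = dropUntil (p , us) u∈p

  toPath : ∀ {u w} → Walk G S u w → Path u w
  toPath [] = [] , []
  toPath (step {u = u} e e∈S j p) with toPath p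
  ... | q , us with DecL._∈?_ _≟_ u (initVertices G S q)
  ...   | yes u∈q = dropUntil (q , us) u∈q
  ...   | no  u∉q = step e e∈S j q , ¬Any⇒All¬ _ u∉q ∷ us

  length-initVertices : ∀ {u w} (p : Walk G S u w) →
                        length (initVertices G S p) ≡ length (edges G S p)
  length-initVertices []             = refl
  length-initVertices (step _ _ _ p) = cong suc (length-initVertices p)

  walk? : ∀ u w → Dec (Walk G S u w)
  walk? u w =
    map′ (λ { (_ , _ , p , _) → p })
         (λ p → let (q , us) = toPath p in
                _ , unique-length us , q , sym (length-initVertices q) , us)
         (anyUpTo? (λ k → walkSatisfying? (λ _ → Unique) (λ _ → DecUnique.unique? _≟_) k u w) (suc n))

  connected? : Dec (Connected G S)
  connected? = all? λ u → all? λ v → walk? u v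

  isSpanningTree? : Dec (IsSpanningTree G S)
  isSpanningTree? = connected? ×-dec acyclic?

allSubsets : (m : ℕ) → List (Subset m)
allSubsets zero    = [ [] ]
allSubsets (suc m) = map (outside ∷_) (allSubsets m) ++ map (inside ∷_) (allSubsets m)

τ : ∀ {n} → Multigraph n → ℕ
τ G = length (filter (isSpanningTree? G) (allSubsets (Multigraph.size G)))

-- The hypothesis on maxMultiplicity forces n ≥ 2, so the denominator is nonzero.
denominator≢0 : ∀ {n} (G : Multigraph n) → 1 ≤ maxMultiplicity G →
                NonZero (maxMultiplicity G * n ^ 2)
denominator≢0 {zero}  G ()
denominator≢0 {suc n} G Δ≥1 =
  m*n≢0 (maxMultiplicity G) (suc n ^ 2) {{>-nonZero Δ≥1}} {{m^n≢0 (suc n) 2}}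

spanningTreeBound : ∀ {n} (G : Multigraph n) → 1 ≤ maxMultiplicity G → ℚ
spanningTreeBound {n} G Δ≥1 =
  _/_ (+ product (map (λ d → maxMultiplicity G + d) (degreeSequence G)))
      (maxMultiplicity G * n ^ 2) {{denominator≢0 G Δ≥1}}

-- Let L be the Laplacian of G on n vertices. The matrix L + ΔJ, with J the all-ones matrix, has determinant
-- Δ n² τ(G), diagonal entries Δ + dᵢ and off-diagonal entries Δ − mᵢⱼ, so the bound is Hadamard's
-- inequality for a positive semidefinite matrix, and equality means that all mᵢⱼ are equal to Δ.
-- Determinants are replaced by Gaussian elimination. For L + t w wᵀ, one elimination step is the star-mesh
-- transformation of the weighted graph together with an update of t and w, and it decreases each remaining
-- diagonal entry by a nonnegative multiple of the square of the eliminated off-diagonal entry. That repeated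
-- star-mesh transformations count spanning trees follows from deletion and contraction: the result does not
-- depend on the order of elimination, so the two ends of an edge may be eliminated last.

{-# OPTIONS --safe #-}
module Submission where

open import Defs
open import Data.Bool using (true; false)
open import Data.Fin using (Fin; zero; suc; _≟_)
open import Data.Fin.Properties using (all?)
open import Data.Fin.Subset using (Subset; inside; outside) renaming (_∈_ to _∈ₛ_)
import Data.Integer.Properties as ℤ
open import Data.List using (List; []; _∷_; _++_; map; filter; length; allFin; tabulate)
open import Data.List.Membership.Propositional using (_∈_; _∉_)
import Data.List.Membership.DecPropositional as DecMembership
open import Data.List.Membership.Propositional.Properties using (∈-∃++; ∈-allFin)
open import Data.List.Properties
  using (filter-++; length-++; filter-none; filter-≐; filter-accept; filter-reject; length-tabulate; map-∘)
import Data.List.Relation.Binary.Permutation.Propositional as ↭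
open ↭ using (_↭_; prep; swap; ↭-sym; ↭-trans; ↭⇒↭ₛ)
open import Data.List.Relation.Binary.Permutation.Propositional.Properties
  using (¬x∷xs↭[]; ++-comm; shift; ∈-resp-↭; map⁺)
open import Data.List.Relation.Binary.Permutation.Setoid.Properties using (Unique-resp-↭)
open import Data.List.Relation.Unary.All as All using (All; []; _∷_)
open import Data.List.Relation.Unary.All.Properties using (¬Any⇒All¬; All¬⇒¬Any)
open import Data.List.Relation.Unary.AllPairs using (AllPairs; []; _∷_)
open import Data.List.Relation.Unary.Any using (here; there)
open import Data.List.Relation.Unary.Unique.Propositional using (Unique)
open import Data.List.Relation.Unary.Unique.Propositional.Properties using (allFin⁺)
open import Data.Nat as ℕ using (ℕ; zero; suc)
open import Data.Nat.ListAction using (product)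
open import Data.Nat.ListAction.Properties using (product-↭)
import Data.Nat.Properties as ℕ
open import Data.List.Sort ℕ.≤-decTotalOrder using (sort-↭)
open import Data.Product using (Σ; ∃; ∃₂; _×_; _,_; proj₁; proj₂)
open import Data.Rational hiding (_≟_)
import Data.Rational.Properties as ℚ
open import Data.Rational.Unnormalised using (mkℚᵘ; *≡*)
open import Data.Sum using (_⊎_; inj₁; inj₂)
open import Data.Vec using ([]; _∷_; here; there)
open import Function using (_∘_; id)
open import Function.Bundles using (_⇔_; mk⇔; Equivalence)
open import Level using (0ℓ)
open import Relation.Binary using (DecidableEquality; Symmetric)
open import Relation.Binary.PropositionalEquality
  using (_≡_; _≢_; refl; sym; trans; cong; cong₂; subst; ≢-sym; setoid; module ≡-Reasoning)
open import Relation.Nullary using (¬_; Dec; yes; no; contradiction; ¬?; does)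
open import Relation.Nullary.Decidable using (dec⇒maybe; _×-dec_)
open import Relation.Unary using (Decidable)
open import Tactic.RingSolver using (solve-∀)
open import Tactic.RingSolver.Core.AlmostCommutativeRing using (AlmostCommutativeRing; fromCommutativeRing)

-- The general rank-one term is forced: elimination does not preserve the all-ones vector, but it
-- does preserve the shape `t w wᵀ` with `t` and `w` positive, and this positivity keeps every pivot
-- and every diagonal entry positive. The Laplacian part alone can have a zero pivot, at an isolated
-- vertex; if other vertices remain, there is no spanning tree, the determinant is 0 and the
-- inequality is strict. Deletion and contraction also have to meet a definition of spanning trees
-- by walks and cycles. The link is Kruskal's algorithm: a set of edges is scanned in index order
-- while a labelling of the vertices records the components joined so far. Leaving an edge out is
-- deletion; taking it identifies two labels, which is contraction. Contraction creates loops, so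
-- weights carry a diagonal, which tree sums never read and degrees subtract.

-- Ordered field arithmetic and elimination identities in ℚ

ℚ-ring : AlmostCommutativeRing 0ℓ 0ℓ
ℚ-ring = fromCommutativeRing ℚ.+-*-commutativeRing (λ x → dec⇒maybe (0ℚ ℚ.≟ x))

+-nonNeg : ∀ {p q} → 0ℚ ≤ p → 0ℚ ≤ q → 0ℚ ≤ p + q
+-nonNeg = ℚ.+-mono-≤

*-nonNeg : ∀ {p q} → 0ℚ ≤ p → 0ℚ ≤ q → 0ℚ ≤ p * q
*-nonNeg {p} {q} 0≤p 0≤q =
  ℚ.nonNegative⁻¹ (p * q) {{ℚ.nonNeg*nonNeg⇒nonNeg p {{nonNegative 0≤p}} q {{nonNegative 0≤q}}}}

*-pos : ∀ {p q} → 0ℚ < p → 0ℚ < q → 0ℚ < p * q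
*-pos {p} {q} 0<p 0<q =
  ℚ.positive⁻¹ (p * q) {{ℚ.pos*pos⇒pos p {{positive 0<p}} q {{positive 0<q}}}}

nonNeg+pos : ∀ {p q} → 0ℚ ≤ p → 0ℚ < q → 0ℚ < p + q
nonNeg+pos = ℚ.+-mono-≤-<

square-nonNeg : ∀ p → 0ℚ ≤ p * p
square-nonNeg p with ℚ.≤-total 0ℚ p
... | inj₁ 0≤p = *-nonNeg 0≤p 0≤p
... | inj₂ p≤0 = subst (0ℚ ≤_) (neg*neg p) (*-nonNeg 0≤-p 0≤-p)
  where
  neg*neg : ∀ p → - p * - p ≡ p * p
  neg*neg = solve-∀ ℚ-ring
  0≤-p : 0ℚ ≤ - p
  0≤-p = ℚ.neg-antimono-≤ p≤0

-- Total, so that the weights after an elimination can be written down before the pivot is known to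
-- be nonzero.
inv : ℚ → ℚ
inv p with p ℚ.≟ 0ℚ
... | yes _   = 0ℚ
... | no  p≢0 = (1/ p) {{≢-nonZero p≢0}}

*-inv : ∀ {p} → p ≢ 0ℚ → p * inv p ≡ 1ℚ
*-inv {p} p≢0 with p ℚ.≟ 0ℚ
... | yes p≡0 = contradiction p≡0 p≢0
... | no  p≢0 = ℚ.*-inverseʳ p {{≢-nonZero p≢0}}

inv-pos : ∀ {p} → 0ℚ < p → 0ℚ < inv p
inv-pos {p} 0<p with p ℚ.≟ 0ℚ
... | yes refl = contradiction 0<p (ℚ.<-irrefl refl)
... | no  p≢0  = ℚ.positive⁻¹ _ {{ℚ.1/pos⇒pos p {{positive 0<p}}}}

≢0⇒pos : ∀ {p} → 0ℚ ≤ p → p ≢ 0ℚ → 0ℚ < p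
≢0⇒pos 0≤p p≢0 = ℚ.≰⇒> λ p≤0 → p≢0 (ℚ.≤-antisym p≤0 0≤p)

inv-nonNeg : ∀ {p} → 0ℚ ≤ p → 0ℚ ≤ inv p
inv-nonNeg {p} 0≤p with p ℚ.≟ 0ℚ
... | yes _   = ℚ.≤-refl
... | no  p≢0 = ℚ.<⇒≤ (ℚ.positive⁻¹ _ {{ℚ.1/pos⇒pos p {{positive (≢0⇒pos 0≤p p≢0)}}}})

pos⇒≢0 : ∀ {p} → 0ℚ < p → p ≢ 0ℚ
pos⇒≢0 0<p p≡0 = ℚ.<⇒≢ 0<p (sym p≡0)

*-cancelˡ : ∀ {p q r} → p ≢ 0ℚ → p * q ≡ p * r → q ≡ r
*-cancelˡ {p} {q} {r} p≢0 eq = begin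
  q                ≡⟨ ℚ.*-identityˡ q ⟨
  1ℚ * q           ≡⟨ cong (_* q) (*-inv p≢0) ⟨
  p * inv p * q    ≡⟨ rearrange p (inv p) q ⟩
  inv p * (p * q)  ≡⟨ cong (inv p *_) eq ⟩
  inv p * (p * r)  ≡⟨ rearrange p (inv p) r ⟨
  p * inv p * r    ≡⟨ cong (_* r) (*-inv p≢0) ⟩
  1ℚ * r           ≡⟨ ℚ.*-identityˡ r ⟩
  r                ∎
  where
  open ≡-Reasoning
  rearrange : ∀ p i q → p * i * q ≡ i * (p * q)
  rearrange = solve-∀ ℚ-ring

square≡0⇒≡0 : ∀ {p} → p * p ≡ 0ℚ → p ≡ 0ℚ
square≡0⇒≡0 {p} eq with p ℚ.≟ 0ℚ
... | yes p≡0 = p≡0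
... | no  p≢0 = *-cancelˡ p≢0 (trans eq (sym (ℚ.*-zeroʳ p)))

+≡0⇒≡0 : ∀ {p q} → 0ℚ ≤ p → 0ℚ ≤ q → p + q ≡ 0ℚ → p ≡ 0ℚ × q ≡ 0ℚ
+≡0⇒≡0 {p} {q} 0≤p 0≤q eq =
  ℚ.≤-antisym (subst (p ≤_) eq (subst (_≤ p + q) (ℚ.+-identityʳ p) (ℚ.+-monoʳ-≤ p 0≤q))) 0≤p ,
  ℚ.≤-antisym (subst (q ≤_) eq (subst (_≤ p + q) (ℚ.+-identityˡ q) (ℚ.+-monoˡ-≤ q 0≤p))) 0≤q

-- Two vertices are joined by weight `c` and have weights `A` and `B` to the rest. The left side is
-- the product of their two successive pivots, the right side the 2×2 principal minor of the
-- Laplacian. If the first pivot is zero, nonnegativity forces `c` and `A` to be zero, and both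
-- sides vanish.
pivot-product : ∀ c A B → 0ℚ ≤ c → 0ℚ ≤ A → (c + A) * (B + c * A * inv (c + A)) ≡ c * B + c * A + A * B
pivot-product c A B 0≤c 0≤A = by-cases ((c + A) ℚ.≟ 0ℚ)
  where
  open ≡-Reasoning
  by-cases : Dec (c + A ≡ 0ℚ) → (c + A) * (B + c * A * inv (c + A)) ≡ c * B + c * A + A * B
  by-cases (yes c+A≡0) = begin
    (c + A) * (B + c * A * inv (c + A))  ≡⟨ cong₂ (λ c A → (c + A) * (B + c * A * inv (c + A))) c≡0 A≡0 ⟩
    (0ℚ + 0ℚ) * (B + 0ℚ * 0ℚ * inv (0ℚ + 0ℚ)) ≡⟨ zeros B (inv (0ℚ + 0ℚ)) ⟩
    0ℚ * B + 0ℚ * 0ℚ + 0ℚ * B            ≡⟨ cong₂ (λ c A → c * B + c * A + A * B) c≡0 A≡0 ⟨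
    c * B + c * A + A * B                ∎
    where
    c≡0 = proj₁ (+≡0⇒≡0 0≤c 0≤A c+A≡0)
    A≡0 = proj₂ (+≡0⇒≡0 0≤c 0≤A c+A≡0)
    zeros : ∀ B i → (0ℚ + 0ℚ) * (B + 0ℚ * 0ℚ * i) ≡ 0ℚ * B + 0ℚ * 0ℚ + 0ℚ * B
    zeros = solve-∀ ℚ-ring
  by-cases (no c+A≢0) = begin
    (c + A) * (B + c * A * inv (c + A))              ≡⟨ expand c A B (inv (c + A)) ⟩
    (c + A) * B + c * A * ((c + A) * inv (c + A))    ≡⟨ cong (λ x → (c + A) * B + c * A * x) (*-inv c+A≢0) ⟩
    (c + A) * B + c * A * 1ℚ                         ≡⟨ collect c A B ⟩
    c * B + c * A + A * B                            ∎
    where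
    expand : ∀ c A B i → (c + A) * (B + c * A * i) ≡ (c + A) * B + c * A * ((c + A) * i)
    expand = solve-∀ ℚ-ring
    collect : ∀ c A B → (c + A) * B + c * A * 1ℚ ≡ c * B + c * A + A * B
    collect = solve-∀ ℚ-ring

pivot-recover : ∀ {c A B d} → (c + A) * inv (c + A) ≡ 1ℚ → d ≡ B + c * A * inv (c + A) → c + B ≡ d + c * c * inv (c + A)
pivot-recover {c} {A} {B} {d} unit eq = sym (begin
  d + c * c * inv (c + A)                          ≡⟨ cong (_+ c * c * inv (c + A)) eq ⟩
  B + c * A * inv (c + A) + c * c * inv (c + A)    ≡⟨ gather c A B (inv (c + A)) ⟩
  c * ((c + A) * inv (c + A)) + B                  ≡⟨ cong (λ x → c * x + B) unit ⟩
  c * 1ℚ + B                                       ≡⟨ cong (_+ B) (ℚ.*-identityʳ c) ⟩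
  c + B                                            ∎)
  where
  open ≡-Reasoning
  gather : ∀ c A B i → B + c * A * i + c * c * i ≡ c * ((c + A) * i) + B
  gather = solve-∀ ℚ-ring

-- Two successive star-mesh transformations amount to one elimination of a 2×2 block: the numerator
-- is the quadratic form of the adjugate of that block, and `q′ + c * c * inv p` is the second
-- diagonal entry before the first elimination. The right side no longer depends on which vertex
-- went first.
starMesh-twice : ∀ w aᵢ aⱼ bᵢ bⱼ c p q′ N → p ≢ 0ℚ → N ≢ 0ℚ → p * q′ ≡ N →
  w + aᵢ * aⱼ * inv p + (bᵢ + c * aᵢ * inv p) * (bⱼ + c * aⱼ * inv p) * inv q′ ≡
  w + ((q′ + c * c * inv p) * (aᵢ * aⱼ) + c * (aᵢ * bⱼ + bᵢ * aⱼ) + p * (bᵢ * bⱼ)) * inv N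
starMesh-twice w aᵢ aⱼ bᵢ bⱼ c p q′ N p≢0 N≢0 refl = begin
  w + aᵢ * aⱼ * P + (bᵢ + c * aᵢ * P) * (bⱼ + c * aⱼ * P) * Q
    ≡⟨ cong₂ (λ x y → w + aᵢ * aⱼ * x + (bᵢ + c * aᵢ * P) * (bⱼ + c * aⱼ * P) * y) P≡ Q≡ ⟩
  w + aᵢ * aⱼ * (q′ * n) + (bᵢ + c * aᵢ * P) * (bⱼ + c * aⱼ * P) * (p * n)
    ≡⟨ expand w aᵢ aⱼ bᵢ bⱼ c p q′ P n ⟩
  w + (q′ * (aᵢ * aⱼ) + (p * P) * (c * c * P * (aᵢ * aⱼ) + c * (aᵢ * bⱼ + bᵢ * aⱼ)) + p * (bᵢ * bⱼ)) * n
    ≡⟨ cong (λ x → w + (q′ * (aᵢ * aⱼ) + x * (c * c * P * (aᵢ * aⱼ) + c * (aᵢ * bⱼ + bᵢ * aⱼ)) + p * (bᵢ * bⱼ)) * n) (*-inv p≢0) ⟩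
  w + (q′ * (aᵢ * aⱼ) + 1ℚ * (c * c * P * (aᵢ * aⱼ) + c * (aᵢ * bⱼ + bᵢ * aⱼ)) + p * (bᵢ * bⱼ)) * n
    ≡⟨ collect w aᵢ aⱼ bᵢ bⱼ c p q′ P n ⟩
  w + ((q′ + c * c * P) * (aᵢ * aⱼ) + c * (aᵢ * bⱼ + bᵢ * aⱼ) + p * (bᵢ * bⱼ)) * n ∎
  where
  open ≡-Reasoning
  P = inv p
  Q = inv q′
  n = inv (p * q′)
  q′≢0 : q′ ≢ 0ℚ
  q′≢0 refl = N≢0 (ℚ.*-zeroʳ p)
  P≡ : P ≡ q′ * n
  P≡ = *-cancelˡ p≢0 (trans (*-inv p≢0) (trans (sym (*-inv N≢0)) (ℚ.*-assoc p q′ n)))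
  Q≡ : Q ≡ p * n
  Q≡ = *-cancelˡ q′≢0 (trans (*-inv q′≢0) (trans (sym (*-inv N≢0)) (shuffle p q′ n)))
    where
    shuffle : ∀ p q n → p * q * n ≡ q * (p * n)
    shuffle = solve-∀ ℚ-ring
  expand : ∀ w aᵢ aⱼ bᵢ bⱼ c p q′ P n →
    w + aᵢ * aⱼ * (q′ * n) + (bᵢ + c * aᵢ * P) * (bⱼ + c * aⱼ * P) * (p * n) ≡
    w + (q′ * (aᵢ * aⱼ) + (p * P) * (c * c * P * (aᵢ * aⱼ) + c * (aᵢ * bⱼ + bᵢ * aⱼ)) + p * (bᵢ * bⱼ)) * n
  expand = solve-∀ ℚ-ring
  collect : ∀ w aᵢ aⱼ bᵢ bⱼ c p q′ P n →
    w + (q′ * (aᵢ * aⱼ) + 1ℚ * (c * c * P * (aᵢ * aⱼ) + c * (aᵢ * bⱼ + bᵢ * aⱼ)) + p * (bᵢ * bⱼ)) * n ≡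
    w + ((q′ + c * c * P) * (aᵢ * aⱼ) + c * (aᵢ * bⱼ + bᵢ * aⱼ) + p * (bᵢ * bⱼ)) * n
  collect = solve-∀ ℚ-ring

-- Sums and products over lists

module _ {V : Set} where

  ∑ ∏ : (V → ℚ) → List V → ℚ
  ∑ f []       = 0ℚ
  ∑ f (v ∷ vs) = f v + ∑ f vs
  ∏ f []       = 1ℚ
  ∏ f (v ∷ vs) = f v * ∏ f vs

  ∑-cong : ∀ {f g vs} → All (λ v → f v ≡ g v) vs → ∑ f vs ≡ ∑ g vs
  ∑-cong []         = refl
  ∑-cong (eq ∷ eqs) = cong₂ _+_ eq (∑-cong eqs)

  ∑-+ : ∀ f g vs → ∑ (λ v → f v + g v) vs ≡ ∑ f vs + ∑ g vs
  ∑-+ f g []       = refl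
  ∑-+ f g (v ∷ vs) = trans (cong (_+_ (f v + g v)) (∑-+ f g vs)) (interchange (f v) (g v) (∑ f vs) (∑ g vs))
    where
    interchange : ∀ a b c d → a + b + (c + d) ≡ a + c + (b + d)
    interchange = solve-∀ ℚ-ring

  ∑-zero : ∀ vs → ∑ (λ _ → 0ℚ) vs ≡ 0ℚ
  ∑-zero []       = refl
  ∑-zero (_ ∷ vs) = trans (ℚ.+-identityˡ _) (∑-zero vs)

  ∑-* : ∀ f c vs → ∑ (λ v → f v * c) vs ≡ ∑ f vs * c
  ∑-* f c []       = sym (ℚ.*-zeroˡ c)
  ∑-* f c (v ∷ vs) = trans (cong (f v * c +_) (∑-* f c vs)) (sym (ℚ.*-distribʳ-+ c (f v) (∑ f vs)))

  ∑-++ : ∀ f us vs → ∑ f (us ++ vs) ≡ ∑ f us + ∑ f vs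
  ∑-++ f []       vs = sym (ℚ.+-identityˡ _)
  ∑-++ f (u ∷ us) vs = trans (cong (f u +_) (∑-++ f us vs)) (sym (ℚ.+-assoc (f u) _ _))

  ∑-↭ : ∀ f {us vs} → us ↭ vs → ∑ f us ≡ ∑ f vs
  ∑-↭ f ↭.refl       = refl
  ∑-↭ f (prep v p)   = cong (f v +_) (∑-↭ f p)
  ∑-↭ f (swap u v p) = trans (cong (λ s → f u + (f v + s)) (∑-↭ f p)) (exchange (f u) (f v) _)
    where
    exchange : ∀ a b c → a + (b + c) ≡ b + (a + c)
    exchange = solve-∀ ℚ-ring
  ∑-↭ f (↭.trans p q) = trans (∑-↭ f p) (∑-↭ f q)

  ∑-nonNeg : ∀ {f} vs → (∀ v → 0ℚ ≤ f v) → 0ℚ ≤ ∑ f vs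
  ∑-nonNeg []       0≤f = ℚ.≤-refl
  ∑-nonNeg (v ∷ vs) 0≤f = +-nonNeg (0≤f v) (∑-nonNeg vs 0≤f)

  ∈⇒≤∑ : ∀ {f} → (∀ v → 0ℚ ≤ f v) → ∀ {v vs} → v ∈ vs → f v ≤ ∑ f vs
  ∈⇒≤∑ {f} 0≤f {v} (here {xs = vs} refl) =
    subst (_≤ f v + ∑ f vs) (ℚ.+-identityʳ (f v)) (ℚ.+-monoʳ-≤ (f v) (∑-nonNeg vs 0≤f))
  ∈⇒≤∑ {f} 0≤f {v} (there {x = u} {xs = vs} v∈vs) =
    subst (_≤ f u + ∑ f vs) (ℚ.+-identityˡ (f v)) (ℚ.+-mono-≤ (0≤f u) (∈⇒≤∑ 0≤f v∈vs))

  ∏-cong : ∀ {f g vs} → All (λ v → f v ≡ g v) vs → ∏ f vs ≡ ∏ g vs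
  ∏-cong []         = refl
  ∏-cong (eq ∷ eqs) = cong₂ _*_ eq (∏-cong eqs)

  ∏-pos : ∀ {f vs} → All (λ v → 0ℚ < f v) vs → 0ℚ < ∏ f vs
  ∏-pos []           = ℚ.positive⁻¹ 1ℚ
  ∏-pos (0<f ∷ 0<fs) = *-pos 0<f (∏-pos 0<fs)

  ∏-mono-≤ : ∀ {f g vs} → All (λ v → 0ℚ < f v) vs → All (λ v → f v ≤ g v) vs → ∏ f vs ≤ ∏ g vs
  ∏-mono-≤ [] [] = ℚ.≤-refl
  ∏-mono-≤ {f} {g} {v ∷ vs} (0<f ∷ 0<fs) (f≤g ∷ fs≤gs) = ℚ.≤-trans
    (ℚ.*-monoˡ-≤-nonNeg (f v) {{nonNegative (ℚ.<⇒≤ 0<f)}} (∏-mono-≤ 0<fs fs≤gs))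
    (ℚ.*-monoʳ-≤-nonNeg (∏ g vs) {{nonNegative (ℚ.≤-trans (ℚ.<⇒≤ (∏-pos 0<fs)) (∏-mono-≤ 0<fs fs≤gs))}} f≤g)

  -- For the head, `f v * ∏ g vs ≥ f v * ∏ f vs = g v * ∏ g vs`, and cancelling the positive `∏ g
  -- vs` gives `f v ≥ g v`. The equal heads then cancel and leave the tails.
  ∏-≡⇒≡ : ∀ {f g vs} → All (λ v → 0ℚ < f v) vs → All (λ v → f v ≤ g v) vs →
          ∏ f vs ≡ ∏ g vs → All (λ v → f v ≡ g v) vs
  ∏-≡⇒≡ []         []         eq = []
  ∏-≡⇒≡ {f} {g} {v ∷ vs} (0<f ∷ 0<fs) (f≤g ∷ fs≤gs) eq =
    fv≡gv ∷ ∏-≡⇒≡ 0<fs fs≤gs (*-cancelˡ (pos⇒≢0 0<f) (trans eq (cong (_* ∏ g vs) (sym fv≡gv))))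
    where
    fv≡gv : f v ≡ g v
    fv≡gv = ℚ.≤-antisym f≤g (ℚ.*-cancelʳ-≤-pos (∏ g vs) {{positive (ℚ.<-≤-trans (∏-pos 0<fs) (∏-mono-≤ 0<fs fs≤gs))}}
      (subst (_≤ f v * ∏ g vs) eq (ℚ.*-monoˡ-≤-nonNeg (f v) {{nonNegative (ℚ.<⇒≤ 0<f)}} (∏-mono-≤ 0<fs fs≤gs))))

  allPairs-zipWith : ∀ {P : V → Set} {R S : V → V → Set} → (∀ {u v} → P u → P v → R u v → S u v) →
                     ∀ {vs} → All P vs → AllPairs R vs → AllPairs S vs
  allPairs-zipWith f []         []         = []
  allPairs-zipWith f (pu ∷ pvs) (rs ∷ rss) =
    All.zipWith (λ (pv , r) → f pu pv r) (pvs , rs) ∷ allPairs-zipWith f pvs rss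

  allPairs-universal : ∀ {R : V → V → Set} → (∀ u v → R u v) → ∀ vs → AllPairs R vs
  allPairs-universal r []       = []
  allPairs-universal r (v ∷ vs) = All.universal (r v) vs ∷ allPairs-universal r vs

  unique⇒allPairs : ∀ {R : V → V → Set} {vs} → Unique vs →
                    (∀ {u v} → u ∈ vs → v ∈ vs → u ≢ v → R u v) → AllPairs R vs
  unique⇒allPairs []       r = []
  unique⇒allPairs (v∉ ∷ u) r =
    All.tabulate (λ w∈ → r (here refl) (there w∈) (All.lookup v∉ w∈)) ∷
    unique⇒allPairs u (λ u∈ v∈ → r (there u∈) (there v∈))

-- Weighted spanning tree sums

Weights : Set → Set
Weights V = V → V → ℚ

module _ {V : Set} where

  record IsGraph (m : Weights V) : Set where
    field
      undirected : ∀ u v → m u v ≡ m v u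
      nonneg     : ∀ u v → 0ℚ ≤ m u v

open IsGraph

module _ {V : Set} where

  -- Here d is meant to be the degree of v. If it is 0, then inv d is 0 as well, which is right
  -- because v is isolated and nothing has to be added.
  starMesh : V → ℚ → Weights V → Weights V
  starMesh v d m i j = m i j + m v i * m v j * inv d

  -- The sum over the spanning trees on vs of the product of their edge weights: a star-mesh
  -- transformation at v divides this sum by the degree of v.
  treeSum : List V → Weights V → ℚ
  treeSum []                m = 1ℚ
  treeSum (v ∷ [])          m = 1ℚ
  treeSum (v ∷ vs@(_ ∷ _)) m = ∑ (m v) vs * treeSum vs (starMesh v (∑ (m v) vs) m)

  starMesh-isGraph : ∀ {m} → IsGraph m → ∀ v {d} → 0ℚ ≤ d → IsGraph (starMesh v d m)
  starMesh-isGraph {m} G v {d} 0≤d .undirected i j =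
    cong₂ _+_ (undirected G i j) (cong (_* inv d) (ℚ.*-comm (m v i) (m v j)))
  starMesh-isGraph G v 0≤d .nonneg i j =
    +-nonNeg (nonneg G i j) (*-nonNeg (*-nonNeg (nonneg G v i) (nonneg G v j)) (inv-nonNeg 0≤d))

  ∑-starMesh : ∀ (m : Weights V) x y d vs → ∑ (starMesh x d m y) vs ≡ ∑ (m y) vs + m x y * ∑ (m x) vs * inv d
  ∑-starMesh m x y d vs = begin
    ∑ (λ j → m y j + m x y * m x j * inv d) vs           ≡⟨ ∑-+ (m y) _ vs ⟩
    ∑ (m y) vs + ∑ (λ j → m x y * m x j * inv d) vs      ≡⟨ cong (∑ (m y) vs +_) (∑-cong (All.universal (λ j → rearrange (m x y) (m x j) (inv d)) vs)) ⟩
    ∑ (m y) vs + ∑ (λ j → m x j * (m x y * inv d)) vs    ≡⟨ cong (∑ (m y) vs +_) (∑-* (m x) _ vs) ⟩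
    ∑ (m y) vs + ∑ (m x) vs * (m x y * inv d)            ≡⟨ cong (∑ (m y) vs +_) (rearrange (m x y) _ _) ⟨
    ∑ (m y) vs + m x y * ∑ (m x) vs * inv d              ∎
    where
    open ≡-Reasoning
    rearrange : ∀ a b c → a * b * c ≡ b * (a * c)
    rearrange = solve-∀ ℚ-ring

  -- Only entries at pairs in list order are ever read, also after a star-mesh transformation. Hence
  -- loops, which sit on the diagonal, can be discarded, and so can rows of labels that have left
  -- the list.
  treeSum-cong : ∀ {vs m m′} → AllPairs (λ i j → m i j ≡ m′ i j) vs → treeSum vs m ≡ treeSum vs m′
  treeSum-cong [] = refl
  treeSum-cong ([] ∷ []) = refl
  treeSum-cong {v ∷ u ∷ us} {m} {m′} (eqs@(_ ∷ _) ∷ eqss) = cong₂ _*_ d≡ (treeSum-cong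
    (allPairs-zipWith (λ eqᵢ eqⱼ eq → cong₂ _+_ eq (cong₂ _*_ (cong₂ _*_ eqᵢ eqⱼ) (cong inv d≡))) eqs eqss))
    where
    d≡ : ∑ (m v) (u ∷ us) ≡ ∑ (m′ v) (u ∷ us)
    d≡ = ∑-cong eqs

  treeSum-ext : ∀ {m m′} vs → (∀ i j → m i j ≡ m′ i j) → treeSum vs m ≡ treeSum vs m′
  treeSum-ext vs eq = treeSum-cong (allPairs-universal eq vs)

  -- Either order of elimination contributes the same minor `N` as the product of its pivots. If `N`
  -- is zero, both sides are zero; otherwise both orders leave the same weights, those of
  -- eliminating the block of `a` and `b` at once.
  treeSum-swap : ∀ {m} → IsGraph m → ∀ a b vs → treeSum (a ∷ b ∷ vs) m ≡ treeSum (b ∷ a ∷ vs) m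
  treeSum-swap {m} G a b [] = cong (λ x → (x + 0ℚ) * 1ℚ) (undirected G a b)
  treeSum-swap {m} G a b vs@(_ ∷ _) = begin
    p * (q′ * treeSum vs ab)  ≡⟨ ℚ.*-assoc p q′ _ ⟨
    p * q′ * treeSum vs ab    ≡⟨ cong (_* treeSum vs ab) pq′ ⟩
    N * treeSum vs ab         ≡⟨ middle ⟩
    N * treeSum vs ba         ≡⟨ cong (_* treeSum vs ba) qp′ ⟨
    q * p′ * treeSum vs ba    ≡⟨ ℚ.*-assoc q p′ _ ⟩
    q * (p′ * treeSum vs ba)  ∎
    where
    open ≡-Reasoning
    A = ∑ (m a) vs
    B = ∑ (m b) vs
    p = m a b + A
    q = m b a + B
    q′ = ∑ (starMesh a p m b) vs
    p′ = ∑ (starMesh b q m a) vs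
    ab = starMesh b q′ (starMesh a p m)
    ba = starMesh a p′ (starMesh b q m)
    c = m a b
    -- N = p q − c² is the principal minor of the Laplacian at a and b.
    N = c * B + c * A + A * B
    0≤A : 0ℚ ≤ A
    0≤A = ∑-nonNeg vs (nonneg G a)
    0≤B : 0ℚ ≤ B
    0≤B = ∑-nonNeg vs (nonneg G b)

    pq′ : p * q′ ≡ N
    pq′ = trans (cong (p *_) (∑-starMesh m a b p vs)) (pivot-product c A B (nonneg G a b) 0≤A)

    qp′ : q * p′ ≡ N
    qp′ = trans (cong (q *_) (∑-starMesh m b a q vs)) (trans (pivot-product (m b a) B A (nonneg G b a) 0≤B)
      (trans (cong (λ c → c * A + c * B + B * A) (undirected G b a)) (flip-N c A B)))
      where
      flip-N : ∀ c A B → c * A + c * B + B * A ≡ c * B + c * A + A * B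
      flip-N = solve-∀ ℚ-ring

    middle : N * treeSum vs ab ≡ N * treeSum vs ba
    middle with N ℚ.≟ 0ℚ
    ... | yes N≡0 = trans (cong (_* treeSum vs ab) N≡0) (trans (ℚ.*-zeroˡ (treeSum vs ab))
                      (trans (sym (ℚ.*-zeroˡ (treeSum vs ba))) (cong (_* treeSum vs ba) (sym N≡0))))
    ... | no N≢0 = cong (N *_) (treeSum-ext vs λ i j →
            trans (starMesh-twice (m i j) (m a i) (m a j) (m b i) (m b j) c p q′ N p≢0 N≢0 pq′)
            (trans (cong (λ x → m i j + x * inv N) (numerator i j))
            (sym (starMesh-twice (m i j) (m b i) (m b j) (m a i) (m a j) (m b a) q p′ N q≢0 N≢0 qp′))))
      where
      pivot-product≢0 : ∀ {x y} → x * y ≡ N → x ≢ 0ℚ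
      pivot-product≢0 {y = y} eq refl = N≢0 (trans (sym eq) (ℚ.*-zeroˡ y))
      p≢0 : p ≢ 0ℚ
      p≢0 = pivot-product≢0 pq′
      q≢0 : q ≢ 0ℚ
      q≢0 = pivot-product≢0 qp′
      numerator : ∀ i j →
        (q′ + c * c * inv p) * (m a i * m a j) + c * (m a i * m b j + m b i * m a j) + p * (m b i * m b j) ≡
        (p′ + m b a * m b a * inv q) * (m b i * m b j) + m b a * (m b i * m a j + m a i * m b j) + q * (m a i * m a j)
      numerator i j = begin
        (q′ + c * c * inv p) * (m a i * m a j) + c * (m a i * m b j + m b i * m a j) + p * (m b i * m b j)
          ≡⟨ cong (λ x → x * (m a i * m a j) + c * (m a i * m b j + m b i * m a j) + p * (m b i * m b j)) q≡ ⟨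
        q * (m a i * m a j) + c * (m a i * m b j + m b i * m a j) + p * (m b i * m b j)
          ≡⟨ reorder (q * (m a i * m a j)) c (m a i * m b j) (m b i * m a j) (p * (m b i * m b j)) ⟩
        p * (m b i * m b j) + c * (m b i * m a j + m a i * m b j) + q * (m a i * m a j)
          ≡⟨ cong₂ (λ x y → x * (m b i * m b j) + y * (m b i * m a j + m a i * m b j) + q * (m a i * m a j)) p≡ (undirected G a b) ⟩
        (p′ + m b a * m b a * inv q) * (m b i * m b j) + m b a * (m b i * m a j + m a i * m b j) + q * (m a i * m a j) ∎
        where
        reorder : ∀ x c u v y → x + c * (u + v) + y ≡ y + c * (v + u) + x
        reorder = solve-∀ ℚ-ring
        q≡ : q ≡ q′ + c * c * inv p
        q≡ = trans (cong (_+ B) (undirected G b a)) (pivot-recover {c} {A} {B} (*-inv p≢0) (∑-starMesh m a b p vs))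
        p≡ : p ≡ p′ + m b a * m b a * inv q
        p≡ = trans (cong (_+ A) (undirected G a b)) (pivot-recover {m b a} {B} {A} (*-inv q≢0) (∑-starMesh m b a q vs))

  -- The equality of the tails is assumed for every graph because eliminating `v` changes the
  -- weights.
  treeSum-∷ : ∀ {us vs} → us ↭ vs → (∀ {m} → IsGraph m → treeSum us m ≡ treeSum vs m) →
              ∀ v {m} → IsGraph m → treeSum (v ∷ us) m ≡ treeSum (v ∷ vs) m
  treeSum-∷ {[]}         {[]}         p eq v G = refl
  treeSum-∷ {[]}         {_ ∷ _}      p eq v G = contradiction (↭-sym p) ¬x∷xs↭[]
  treeSum-∷ {_ ∷ _}      {[]}         p eq v G = contradiction p ¬x∷xs↭[]
  treeSum-∷ {us@(_ ∷ _)} {vs@(_ ∷ _)} p eq v {m} G = trans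
    (cong (∑ (m v) us *_) (eq (starMesh-isGraph G v (∑-nonNeg us (nonneg G v)))))
    (cong (λ d → d * treeSum vs (starMesh v d m)) (∑-↭ (m v) p))

  treeSum-↭ : ∀ {us vs} → us ↭ vs → ∀ {m} → IsGraph m → treeSum us m ≡ treeSum vs m
  treeSum-↭ ↭.refl G = refl
  treeSum-↭ (prep v p) G = treeSum-∷ p (treeSum-↭ p) v G
  treeSum-↭ (swap {xs} u v p) G = trans (treeSum-swap G u v xs)
    (treeSum-∷ (prep u p) (treeSum-∷ p (treeSum-↭ p) u) v G)
  treeSum-↭ (↭.trans p q) G = trans (treeSum-↭ p G) (treeSum-↭ q G)

-- Hadamard's inequality

module _ {V : Set} where

  -- The diagonal of a weight function plays no role, so it is taken out of the row sum.
  deg : List V → Weights V → V → ℚ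
  deg vs m v = ∑ (m v) vs - m v v

  deg-nonNeg : ∀ {m} → IsGraph m → ∀ {v vs} → v ∈ vs → 0ℚ ≤ deg vs m v
  deg-nonNeg {m} G {v} {vs} v∈vs =
    subst (_≤ ∑ (m v) vs - m v v) (ℚ.+-inverseʳ (m v v)) (ℚ.+-monoˡ-≤ (- m v v) (∈⇒≤∑ (nonneg G v) v∈vs))

  diagonal : List V → Weights V → ℚ → (V → ℚ) → V → ℚ
  diagonal vs m t w v = deg vs m v + t * (w v * w v)

  diagonal-pos : ∀ {m} → IsGraph m → ∀ {t w} → 0ℚ < t → (∀ v → 0ℚ < w v) →
                 ∀ vs → All (λ v → 0ℚ < diagonal vs m t w v) vs
  diagonal-pos G 0<t 0<w vs =
    All.tabulate λ {v} v∈vs → nonNeg+pos (deg-nonNeg G v∈vs) (*-pos 0<t (*-pos (0<w v) (0<w v)))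

  -- The determinant of L + t w wᵀ, where L is the Laplacian of m.
  augmentedDet : List V → Weights V → ℚ → (V → ℚ) → ℚ
  augmentedDet vs m t w = t * (∑ w vs * ∑ w vs) * treeSum vs m

  -- The off-diagonal entries of `L + t w wᵀ` are `t wᵢ wⱼ − mᵢⱼ`, so this says that the matrix is
  -- diagonal.
  IsDiagonal : List V → Weights V → ℚ → (V → ℚ) → Set
  IsDiagonal vs m t w = AllPairs (λ i j → m i j ≡ t * (w i * w j)) vs

  Hadamard : List V → Weights V → ℚ → (V → ℚ) → Set
  Hadamard vs m t w = augmentedDet vs m t w ≤ ∏ (diagonal vs m t w) vs ×
                      (augmentedDet vs m t w ≡ ∏ (diagonal vs m t w) vs ⇔ IsDiagonal vs m t w)

  -- Induction on the vertices, one Schur complement per step. The list is nonempty because on the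
  -- empty one `augmentedDet` is 0 and the product is 1 although `IsDiagonal` holds.
  hadamard : ∀ v vs {m t w} → IsGraph m → 0ℚ < t → (∀ i → 0ℚ < w i) → Hadamard (v ∷ vs) m t w
  hadamard v [] {m} {t} {w} G 0<t 0<w = ℚ.≤-reflexive single , mk⇔ (λ _ → [] ∷ []) (λ _ → single)
    where
    identity : ∀ t w m → t * ((w + 0ℚ) * (w + 0ℚ)) * 1ℚ ≡ (m + 0ℚ - m + t * (w * w)) * 1ℚ
    identity = solve-∀ ℚ-ring
    single : augmentedDet (v ∷ []) m t w ≡ ∏ (diagonal (v ∷ []) m t w) (v ∷ [])
    single = identity t (w v) (m v v)
  hadamard v vs@(v₁ ∷ vs₁) {m} {t} {w} G 0<t 0<w = by-cases (d ℚ.≟ 0ℚ)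
    where
    open ≡-Reasoning
    d = ∑ (m v) vs
    us = v ∷ vs

    0≤d : 0ℚ ≤ d
    0≤d = ∑-nonNeg vs (nonneg G v)

    0<∏ : 0ℚ < ∏ (diagonal us m t w) us
    0<∏ = ∏-pos (diagonal-pos G 0<t 0<w us)

    by-cases : Dec (d ≡ 0ℚ) → Hadamard us m t w
    -- Here `v` is isolated: the determinant is 0 and the product positive. A diagonal matrix would
    -- need `m v v₁ = t * (w v * w v₁) > 0`, contradicting `d ≡ 0ℚ`.
    by-cases (yes d≡0) = subst (_≤ ∏ (diagonal us m t w) us) (sym augmentedDet≡0) (ℚ.<⇒≤ 0<∏) ,
      mk⇔ (λ eq → contradiction (trans (sym augmentedDet≡0) eq) (ℚ.<⇒≢ 0<∏))
          (λ { ((mvv₁ ∷ _) ∷ _) → contradiction d≡0 (pos⇒≢0 (ℚ.<-≤-trans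
                 (subst (0ℚ <_) (sym mvv₁) (*-pos 0<t (*-pos (0<w v) (0<w v₁))))
                 (∈⇒≤∑ {f = m v} (nonneg G v) {vs = vs} (here refl)))) })
      where
      vanish : ∀ a x → a * (0ℚ * x) ≡ 0ℚ
      vanish = solve-∀ ℚ-ring
      augmentedDet≡0 : augmentedDet us m t w ≡ 0ℚ
      augmentedDet≡0 = trans (cong (λ x → t * (∑ w us * ∑ w us) * (x * treeSum vs (starMesh v d m))) d≡0)
        (vanish (t * (∑ w us * ∑ w us)) (treeSum vs (starMesh v d m)))
    by-cases (no d≢0) = bound , mk⇔ to from
      where
      0<d : 0ℚ < d
      0<d = ≢0⇒pos 0≤d d≢0
      α : V → ℚ
      α j = m v j * inv d
      p = d + t * (w v * w v)
      0<p : 0ℚ < p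
      0<p = nonNeg+pos 0≤d (*-pos 0<t (*-pos (0<w v) (0<w v)))
      p≢0 : p ≢ 0ℚ
      p≢0 = pos⇒≢0 0<p
      m′ = starMesh v d m
      -- Completing the square in `L` uses `y = x_v − Σ αⱼ xⱼ`, which turns `w · x` into `w_v y + s`
      -- with `s = w′ · x` over the remaining vertices. Minimising `d y² + t (w_v y + s)²` over `y`
      -- leaves `(t d / p) s²`.
      t′ = t * d * inv p
      w′ : V → ℚ
      w′ j = w j + w v * α j
      -- The entry of `L + t w wᵀ` at row `v` and column `j`.
      defect : V → ℚ
      defect j = t * w v * w j - m v j

      G′ : IsGraph m′
      G′ = starMesh-isGraph G v 0≤d
      0<t′ : 0ℚ < t′
      0<t′ = *-pos (*-pos 0<t 0<d) (inv-pos 0<p)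
      0<w′ : ∀ j → 0ℚ < w′ j
      0<w′ j = subst (0ℚ <_) (ℚ.+-comm (w v * α j) (w j))
        (nonNeg+pos (*-nonNeg (ℚ.<⇒≤ (0<w v)) (*-nonNeg (nonneg G v j) (inv-nonNeg 0≤d))) (0<w j))

      IH : Hadamard vs m′ t′ w′
      IH = hadamard v₁ vs₁ G′ 0<t′ 0<w′

      dα : ∀ j → d * α j ≡ m v j
      dα j = trans (rearrange d (m v j) (inv d)) (trans (cong (m v j *_) (*-inv d≢0)) (ℚ.*-identityʳ (m v j)))
        where
        rearrange : ∀ d c i → d * (c * i) ≡ c * (d * i)
        rearrange = solve-∀ ℚ-ring

      m′≡ : ∀ i j → m′ i j ≡ m i j + d * α i * α j
      m′≡ i j = cong (m i j +_) (trans (ℚ.*-assoc (m v i) (m v j) (inv d)) (cong (_* α j) (sym (dα i))))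

      -- The `α j` sum to 1, so the mass of `v` is redistributed over its neighbours and the total
      -- stays the same. This is why the factor `∑ w vs * ∑ w vs` of `augmentedDet` survives the
      -- step.
      ∑w′ : ∑ w′ vs ≡ w v + ∑ w vs
      ∑w′ = begin
        ∑ w′ vs                                            ≡⟨ ∑-+ w _ vs ⟩
        ∑ w vs + ∑ (λ j → w v * α j) vs                    ≡⟨ cong (∑ w vs +_) (∑-cong (All.universal (λ j → rearrange (w v) (m v j) (inv d)) vs)) ⟩
        ∑ w vs + ∑ (λ j → m v j * (w v * inv d)) vs        ≡⟨ cong (∑ w vs +_) (∑-* (m v) (w v * inv d) vs) ⟩
        ∑ w vs + d * (w v * inv d)                         ≡⟨ cong (∑ w vs +_) (rearrange (w v) d (inv d)) ⟨
        ∑ w vs + w v * (d * inv d)                         ≡⟨ cong (λ x → ∑ w vs + w v * x) (*-inv d≢0) ⟩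
        ∑ w vs + w v * 1ℚ                                  ≡⟨ finish (∑ w vs) (w v) ⟩
        w v + ∑ w vs                                       ∎
        where
        rearrange : ∀ a b c → a * (b * c) ≡ b * (a * c)
        rearrange = solve-∀ ℚ-ring
        finish : ∀ a b → a + b * 1ℚ ≡ b + a
        finish = solve-∀ ℚ-ring

      augmentedDet-step : augmentedDet us m t w ≡ p * augmentedDet vs m′ t′ w′
      augmentedDet-step = begin
        t * (W * W) * (d * T)                   ≡⟨ cong (λ W → t * (W * W) * (d * T)) ∑w′ ⟨
        t * (W′ * W′) * (d * T)                 ≡⟨ introduce t W′ d T ⟩
        1ℚ * (t * d * (W′ * W′) * T)            ≡⟨ cong (_* (t * d * (W′ * W′) * T)) (*-inv p≢0) ⟨
        p * inv p * (t * d * (W′ * W′) * T)     ≡⟨ rearrange t W′ d T p (inv p) ⟩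
        p * (t * d * inv p * (W′ * W′) * T)     ∎
        where
        T = treeSum vs m′
        W = ∑ w us
        W′ = ∑ w′ vs
        introduce : ∀ t W d T → t * (W * W) * (d * T) ≡ 1ℚ * (t * d * (W * W) * T)
        introduce = solve-∀ ℚ-ring
        rearrange : ∀ t W d T p i → p * i * (t * d * (W * W) * T) ≡ p * (t * d * i * (W * W) * T)
        rearrange = solve-∀ ℚ-ring

      pivot : diagonal us m t w v ≡ p
      pivot = cancel (m v v) d (t * (w v * w v))
        where
        cancel : ∀ a d x → a + d - a + x ≡ d + x
        cancel = solve-∀ ℚ-ring

      diagonal-step : ∀ j → diagonal us m t w j ≡ diagonal vs m′ t′ w′ j + defect j * defect j * inv p
      diagonal-step j = sym (begin
        diagonal vs m′ t′ w′ j + defect j * defect j * inv p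
          ≡⟨ cong₂ (λ x y → x + t * d * inv p * (w′ j * w′ j) + (t * w v * w j - y) * (t * w v * w j - y) * inv p)
               deg′ (sym (dα j)) ⟩
        deg us m j - d * α j * α j + t * d * inv p * (w′ j * w′ j) + (t * w v * w j - d * α j) * (t * w v * w j - d * α j) * inv p
          ≡⟨ brahmagupta (deg us m j) d (w v) (w j) (α j) t (inv p) ⟩
        deg us m j - d * α j * α j + p * inv p * (t * (w j * w j) + d * α j * α j)
          ≡⟨ cong (λ x → deg us m j - d * α j * α j + x * (t * (w j * w j) + d * α j * α j)) (*-inv p≢0) ⟩
        deg us m j - d * α j * α j + 1ℚ * (t * (w j * w j) + d * α j * α j)
          ≡⟨ finish (deg us m j) (d * α j * α j) (t * (w j * w j)) ⟩
        diagonal us m t w j ∎)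
        where
        -- Brahmagupta's identity `(d + t w₀²)(t w² + d α²) = t d (w + w₀ α)² + (t w₀ w − d
        -- α)²`, multiplied by `P` and shifted by `D − d α²`.
        brahmagupta : ∀ D d w₀ w α t P →
          D - d * α * α + t * d * P * ((w + w₀ * α) * (w + w₀ * α)) + (t * w₀ * w - d * α) * (t * w₀ * w - d * α) * P ≡
          D - d * α * α + (d + t * (w₀ * w₀)) * P * (t * (w * w) + d * α * α)
        brahmagupta = solve-∀ ℚ-ring
        finish : ∀ D x y → D - x + 1ℚ * (y + x) ≡ D + y
        finish = solve-∀ ℚ-ring
        -- Vertex `j` loses its edge of weight `c = m v j` to `v` and gains `c (d − c) / d` from the
        -- mesh, a net loss of `c² / d = d α²`.
        deg′ : deg vs m′ j ≡ deg us m j - d * α j * α j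
        deg′ = begin
          ∑ (m′ j) vs - m′ j j
            ≡⟨ cong₂ _-_ (∑-starMesh m v j d vs) (m′≡ j j) ⟩
          ∑ (m j) vs + m v j * d * inv d - (m j j + d * α j * α j)
            ≡⟨ cong (λ x → ∑ (m j) vs + x - (m j j + d * α j * α j)) full ⟩
          ∑ (m j) vs + m j v - (m j j + d * α j * α j)
            ≡⟨ regroup (∑ (m j) vs) (m j v) (m j j) (d * α j * α j) ⟩
          m j v + ∑ (m j) vs - m j j - d * α j * α j ∎
          where
          full : m v j * d * inv d ≡ m j v
          full = trans (ℚ.*-assoc (m v j) d (inv d)) (trans (cong (m v j *_) (*-inv d≢0))
                   (trans (ℚ.*-identityʳ (m v j)) (undirected G v j)))
          regroup : ∀ s c x y → s + c - (x + y) ≡ c + s - x - y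
          regroup = solve-∀ ℚ-ring

      shrinks : All (λ j → diagonal vs m′ t′ w′ j ≤ diagonal us m t w j) vs
      shrinks = All.universal (λ j → subst (diagonal vs m′ t′ w′ j ≤_) (sym (diagonal-step j))
        (subst (_≤ diagonal vs m′ t′ w′ j + defect j * defect j * inv p) (ℚ.+-identityʳ (diagonal vs m′ t′ w′ j))
          (ℚ.+-monoʳ-≤ (diagonal vs m′ t′ w′ j) (*-nonNeg (square-nonNeg (defect j)) (ℚ.<⇒≤ (inv-pos 0<p)))))) vs

      positive′ : All (λ j → 0ℚ < diagonal vs m′ t′ w′ j) vs
      positive′ = diagonal-pos G′ 0<t′ 0<w′ vs

      ∏-step : ∏ (diagonal us m t w) us ≡ p * ∏ (diagonal us m t w) vs
      ∏-step = cong (_* ∏ (diagonal us m t w) vs) pivot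

      bound′ : ∏ (diagonal vs m′ t′ w′) vs ≤ ∏ (diagonal us m t w) vs
      bound′ = ∏-mono-≤ positive′ shrinks

      bound : augmentedDet us m t w ≤ ∏ (diagonal us m t w) us
      bound = subst (_≤ ∏ (diagonal us m t w) us) (sym augmentedDet-step) (subst (p * augmentedDet vs m′ t′ w′ ≤_) (sym ∏-step)
        (ℚ.*-monoˡ-≤-nonNeg p {{nonNegative (ℚ.<⇒≤ 0<p)}} (ℚ.≤-trans (proj₁ IH) bound′)))

      Perpendicular : V → Set
      Perpendicular j = m v j ≡ t * (w v * w j)

      -- Given dαᵢ = t w₀ wᵢ, one has d w′ᵢ = p wᵢ, which makes both sides below differ by the same amount.
      off-diagonal : ∀ {i j} → Perpendicular i → t′ * (w′ i * w′ j) ≡ t * (w i * w j) + d * α i * α j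
      off-diagonal {i} {j} eq = begin
        t * d * inv p * ((w i + w v * α i) * (w j + w v * α j))
          ≡⟨ rearrange t d (inv p) (w i) (w v) (α i) (w j + w v * α j) ⟩
        t * inv p * (d * w i + w v * (d * α i)) * (w j + w v * α j)
          ≡⟨ cong (λ x → t * inv p * (d * w i + w v * x) * (w j + w v * α j)) dαᵢ ⟩
        t * inv p * (d * w i + w v * (t * (w v * w i))) * (w j + w v * α j)
          ≡⟨ factor t d (inv p) (w i) (w v) (w j) (α j) ⟩
        p * inv p * (t * (w i * w j) + t * (w v * w i) * α j)
          ≡⟨ cong₂ (λ x y → x * (t * (w i * w j) + y * α j)) (*-inv p≢0) (sym dαᵢ) ⟩
        1ℚ * (t * (w i * w j) + d * α i * α j)
          ≡⟨ ℚ.*-identityˡ _ ⟩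
        t * (w i * w j) + d * α i * α j ∎
        where
        dαᵢ : d * α i ≡ t * (w v * w i)
        dαᵢ = trans (dα i) eq
        rearrange : ∀ t d P wᵢ w₀ αᵢ x → t * d * P * ((wᵢ + w₀ * αᵢ) * x) ≡ t * P * (d * wᵢ + w₀ * (d * αᵢ)) * x
        rearrange = solve-∀ ℚ-ring
        factor : ∀ t d P wᵢ w₀ wⱼ αⱼ → t * P * (d * wᵢ + w₀ * (t * (w₀ * wᵢ))) * (wⱼ + w₀ * αⱼ) ≡
                 (d + t * (w₀ * w₀)) * P * (t * (wᵢ * wⱼ) + t * (w₀ * wᵢ) * αⱼ)
        factor = solve-∀ ℚ-ring

      from : IsDiagonal us m t w → augmentedDet us m t w ≡ ∏ (diagonal us m t w) us
      from (perp ∷ diag) = begin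
        augmentedDet us m t w                  ≡⟨ augmentedDet-step ⟩
        p * augmentedDet vs m′ t′ w′           ≡⟨ cong (p *_) (Equivalence.from (proj₂ IH) diag′) ⟩
        p * ∏ (diagonal vs m′ t′ w′) vs  ≡⟨ cong (p *_) (∏-cong (All.map (λ {j} → unchanged j) perp)) ⟩
        p * ∏ (diagonal us m t w) vs     ≡⟨ ∏-step ⟨
        ∏ (diagonal us m t w) us         ∎
        where
        diag′ : IsDiagonal vs m′ t′ w′
        diag′ = allPairs-zipWith (λ {i} {j} perpᵢ _ eq →
          trans (m′≡ i j) (trans (cong (_+ d * α i * α j) eq) (sym (off-diagonal perpᵢ)))) perp diag
        unchanged : ∀ j → Perpendicular j → diagonal vs m′ t′ w′ j ≡ diagonal us m t w j
        unchanged j eq = sym (begin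
          diagonal us m t w j                                                       ≡⟨ diagonal-step j ⟩
          diagonal vs m′ t′ w′ j + defect j * defect j * inv p                      ≡⟨ cong (λ x → diagonal vs m′ t′ w′ j + (t * w v * w j - x) * (t * w v * w j - x) * inv p) eq ⟩
          diagonal vs m′ t′ w′ j + (t * w v * w j - t * (w v * w j)) * (t * w v * w j - t * (w v * w j)) * inv p ≡⟨ vanish (diagonal vs m′ t′ w′ j) t (w v) (w j) (inv p) ⟩
          diagonal vs m′ t′ w′ j                                                    ∎)
          where
          vanish : ∀ D t x y P → D + (t * x * y - t * (x * y)) * (t * x * y - t * (x * y)) * P ≡ D
          vanish = solve-∀ ℚ-ring

      to : augmentedDet us m t w ≡ ∏ (diagonal us m t w) us → IsDiagonal us m t w
      to eq = perp ∷ diag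
        where
        tight : augmentedDet vs m′ t′ w′ ≡ ∏ (diagonal us m t w) vs
        tight = *-cancelˡ p≢0 (trans (sym augmentedDet-step) (trans eq ∏-step))
        -- The smaller determinant is at most the product of the new diagonal, which is at most that
        -- of the old one. By `tight` the outer terms agree, so the middle one agrees with them.
        ∏-tight : ∏ (diagonal vs m′ t′ w′) vs ≡ ∏ (diagonal us m t w) vs
        ∏-tight = ℚ.≤-antisym bound′ (subst (_≤ ∏ (diagonal vs m′ t′ w′) vs) tight (proj₁ IH))
        perpendicular : ∀ j → diagonal vs m′ t′ w′ j ≡ diagonal us m t w j → Perpendicular j
        perpendicular j same = begin
          m v j                                ≡⟨ complement (m v j) (t * w v * w j) ⟩
          t * w v * w j - defect j             ≡⟨ cong (λ x → t * w v * w j - x) defect≡0 ⟩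
          t * w v * w j - 0ℚ                   ≡⟨ reassociate t (w v) (w j) ⟩
          t * (w v * w j)                      ∎
          where
          complement : ∀ a b → a ≡ b - (b - a)
          complement = solve-∀ ℚ-ring
          reassociate : ∀ a b c → a * b * c - 0ℚ ≡ a * (b * c)
          reassociate = solve-∀ ℚ-ring
          subtract : ∀ a b → b ≡ a + b - a
          subtract = solve-∀ ℚ-ring
          excess≡0 : defect j * defect j * inv p ≡ 0ℚ
          excess≡0 = begin
            defect j * defect j * inv p                                                     ≡⟨ subtract (diagonal vs m′ t′ w′ j) (defect j * defect j * inv p) ⟩
            diagonal vs m′ t′ w′ j + defect j * defect j * inv p - diagonal vs m′ t′ w′ j   ≡⟨ cong₂ _-_ (sym (diagonal-step j)) same ⟩
            diagonal us m t w j - diagonal us m t w j                                       ≡⟨ ℚ.+-inverseʳ (diagonal us m t w j) ⟩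
            0ℚ                                                                              ∎
          defect≡0 : defect j ≡ 0ℚ
          defect≡0 = square≡0⇒≡0 (*-cancelˡ (pos⇒≢0 (inv-pos 0<p))
            (trans (ℚ.*-comm (inv p) _) (trans excess≡0 (sym (ℚ.*-zeroʳ (inv p))))))
        perp : All Perpendicular vs
        perp = All.map (λ {j} → perpendicular j) (∏-≡⇒≡ positive′ shrinks ∏-tight)
        diag : IsDiagonal vs m t w
        diag = allPairs-zipWith (λ {i} {j} perpᵢ _ eq′ → begin
            m i j                                              ≡⟨ add-subtract (m i j) (d * α i * α j) ⟩
            m i j + d * α i * α j - d * α i * α j              ≡⟨ cong (_- d * α i * α j) (m′≡ i j) ⟨
            m′ i j - d * α i * α j                             ≡⟨ cong (_- d * α i * α j) (trans eq′ (off-diagonal perpᵢ)) ⟩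
            t * (w i * w j) + d * α i * α j - d * α i * α j    ≡⟨ add-subtract (t * (w i * w j)) (d * α i * α j) ⟨
            t * (w i * w j)                                    ∎)
          perp (Equivalence.to (proj₂ IH) (trans tight (sym ∏-tight)))
          where
          add-subtract : ∀ a b → a ≡ a + b - b
          add-subtract = solve-∀ ℚ-ring

-- Deletion and contraction

module _ {V : Set} where
  treeSum-unfold : ∀ (v : V) ws x xs m → treeSum (v ∷ ws ++ x ∷ xs) m ≡
    ∑ (m v) (ws ++ x ∷ xs) * treeSum (ws ++ x ∷ xs) (starMesh v (∑ (m v) (ws ++ x ∷ xs)) m)
  treeSum-unfold v []      x xs m = refl
  treeSum-unfold v (_ ∷ _) x xs m = refl

module _ {V : Set} (_≟_ : DecidableEquality V) where

  δ : V → V → ℚ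
  δ u v with u ≟ v
  ... | yes _ = 1ℚ
  ... | no  _ = 0ℚ

  δ-≡ : ∀ v → δ v v ≡ 1ℚ
  δ-≡ v with v ≟ v
  ... | yes _   = refl
  ... | no  v≢v = contradiction refl v≢v

  δ-≢ : ∀ {u v} → u ≢ v → δ u v ≡ 0ℚ
  δ-≢ {u} {v} u≢v with u ≟ v
  ... | yes u≡v = contradiction u≡v u≢v
  ... | no  _   = refl

  δ-nonNeg : ∀ u v → 0ℚ ≤ δ u v
  δ-nonNeg u v with u ≟ v
  ... | yes _ = ℚ.nonNegative⁻¹ 1ℚ
  ... | no  _ = ℚ.≤-refl

  δ-sym : ∀ u v → δ u v ≡ δ v u
  δ-sym u v with u ≟ v
  ... | yes refl = sym (δ-≡ v)
  ... | no  u≢v  = sym (δ-≢ (≢-sym u≢v))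

  δ-disjoint : ∀ u {i j} → i ≢ j → δ u i * δ u j ≡ 0ℚ
  δ-disjoint u {i} {j} i≢j with u ≟ i
  ... | yes refl = trans (cong (1ℚ *_) (δ-≢ i≢j)) (ℚ.*-zeroʳ 1ℚ)
  ... | no _     = ℚ.*-zeroˡ (δ u j)

  link : V → V → Weights V
  link u v i j = δ u i * δ v j + δ u j * δ v i

  _⊕_ : Weights V → Weights V → Weights V
  (m ⊕ m′) i j = m i j + m′ i j

  -- This is `E m Eᵀ` with `E = I + e_u e_vᵀ`: row and column `v` are added to row and column `u`.
  -- The old row `v` stays behind and disappears only because `v` is removed from the list of
  -- vertices. Writing it with `δ` makes it a polynomial identity to work with.
  contract : V → V → Weights V → Weights V
  contract u v m i j = m i j + δ u i * m v j + δ u j * m i v + δ u i * δ u j * m v v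

  link-isGraph : ∀ u v → IsGraph (link u v)
  link-isGraph u v .undirected i j = ℚ.+-comm (δ u i * δ v j) (δ u j * δ v i)
  link-isGraph u v .nonneg     i j =
    +-nonNeg (*-nonNeg (δ-nonNeg u i) (δ-nonNeg v j)) (*-nonNeg (δ-nonNeg u j) (δ-nonNeg v i))

  ⊕-isGraph : ∀ {m m′} → IsGraph m → IsGraph m′ → IsGraph (m ⊕ m′)
  ⊕-isGraph G G′ .undirected i j = cong₂ _+_ (undirected G i j) (undirected G′ i j)
  ⊕-isGraph G G′ .nonneg     i j = +-nonNeg (nonneg G i j) (nonneg G′ i j)

  contract-isGraph : ∀ {m} u v → IsGraph m → IsGraph (contract u v m)
  contract-isGraph {m} u v G .undirected i j = trans
    (cong₂ (λ x y → m i j + δ u i * x + δ u j * y + δ u i * δ u j * m v v) (undirected G v j) (undirected G i v))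
    (trans (cong (λ x → x + δ u i * m j v + δ u j * m v i + δ u i * δ u j * m v v) (undirected G i j))
           (exchange (m j i) (δ u i) (δ u j) (m j v) (m v i) (m v v)))
    where
    exchange : ∀ w a b x y z → w + a * x + b * y + a * b * z ≡ w + b * y + a * x + b * a * z
    exchange = solve-∀ ℚ-ring
  contract-isGraph u v G .nonneg i j = +-nonNeg (+-nonNeg (+-nonNeg (nonneg G i j)
    (*-nonNeg (δ-nonNeg u i) (nonneg G v j))) (*-nonNeg (δ-nonNeg u j) (nonneg G i v)))
    (*-nonNeg (*-nonNeg (δ-nonNeg u i) (δ-nonNeg u j)) (nonneg G v v))

  link-avoids : ∀ {u v z} → u ≢ z → v ≢ z → ∀ j → link u v z j ≡ 0ℚ
  link-avoids {u} {v} u≢z v≢z j =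
    trans (cong₂ (λ a b → a * δ v j + δ u j * b) (δ-≢ u≢z) (δ-≢ v≢z)) (vanish (δ v j) (δ u j))
    where
    vanish : ∀ a b → 0ℚ * a + b * 0ℚ ≡ 0ℚ
    vanish = solve-∀ ℚ-ring

  -- Eliminating every vertex other than the ends of the new edge leaves a two-vertex graph.
  deletion-contraction-last : ∀ {u v} → u ≢ v → ∀ ws → All (u ≢_) ws → All (v ≢_) ws → ∀ m →
    treeSum (ws ++ u ∷ v ∷ []) (link u v ⊕ m) ≡
    treeSum (ws ++ u ∷ v ∷ []) m + treeSum (ws ++ u ∷ []) (contract u v m)
  deletion-contraction-last {u} {v} u≢v [] _ _ m = begin
    (δ u u * δ v v + δ u v * δ v u + m u v + 0ℚ) * 1ℚ
      ≡⟨ cong₂ (λ x y → (x + y + m u v + 0ℚ) * 1ℚ) (cong₂ _*_ (δ-≡ u) (δ-≡ v)) (cong₂ _*_ (δ-≢ u≢v) (δ-≢ (≢-sym u≢v))) ⟩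
    (1ℚ * 1ℚ + 0ℚ * 0ℚ + m u v + 0ℚ) * 1ℚ
      ≡⟨ evaluate (m u v) ⟩
    (m u v + 0ℚ) * 1ℚ + 1ℚ ∎
    where
    open ≡-Reasoning
    evaluate : ∀ x → (1ℚ * 1ℚ + 0ℚ * 0ℚ + x + 0ℚ) * 1ℚ ≡ (x + 0ℚ) * 1ℚ + 1ℚ
    evaluate = solve-∀ ℚ-ring
  deletion-contraction-last {u} {v} u≢v (z ∷ ws) (u≢z ∷ u∉) (v≢z ∷ v∉) m = begin
    treeSum (z ∷ ws ++ u ∷ v ∷ []) m⁺              ≡⟨ treeSum-unfold z ws u (v ∷ []) m⁺ ⟩
    d⁺ * treeSum us (starMesh z d⁺ m⁺)             ≡⟨ cong (λ d → d * treeSum us (starMesh z d m⁺)) d⁺≡d ⟩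
    d * treeSum us (starMesh z d m⁺)               ≡⟨ cong (d *_) (treeSum-ext us mesh⁺) ⟩
    d * treeSum us (link u v ⊕ m′)                 ≡⟨ cong (d *_) (deletion-contraction-last u≢v ws u∉ v∉ m′) ⟩
    d * (treeSum us m′ + treeSum us₀ (contract u v m′))
      ≡⟨ ℚ.*-distribˡ-+ d (treeSum us m′) (treeSum us₀ (contract u v m′)) ⟩
    d * treeSum us m′ + d * treeSum us₀ (contract u v m′)
      ≡⟨ cong₂ (λ x y → x + d * y) (treeSum-unfold z ws u (v ∷ []) m) (treeSum-ext us₀ mesh₀) ⟨
    treeSum (z ∷ us) m + d * treeSum us₀ (starMesh z d m₀)
      ≡⟨ cong (λ d → treeSum (z ∷ us) m + d * treeSum us₀ (starMesh z d m₀)) d₀≡d ⟨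
    treeSum (z ∷ us) m + d₀ * treeSum us₀ (starMesh z d₀ m₀)
      ≡⟨ cong (treeSum (z ∷ us) m +_) (treeSum-unfold z ws u [] m₀) ⟨
    treeSum (z ∷ us) m + treeSum (z ∷ us₀) m₀      ∎
    where
    open ≡-Reasoning
    us = ws ++ u ∷ v ∷ []
    us₀ = ws ++ u ∷ []
    m⁺ = link u v ⊕ m
    m₀ = contract u v m
    d = ∑ (m z) us
    d⁺ = ∑ (m⁺ z) us
    d₀ = ∑ (m₀ z) us₀
    m′ = starMesh z d m

    m⁺z : ∀ j → m⁺ z j ≡ m z j
    m⁺z j = trans (cong (_+ m z j) (link-avoids u≢z v≢z j)) (ℚ.+-identityˡ (m z j))

    m₀z : ∀ j → m₀ z j ≡ m z j + δ u j * m z v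
    m₀z j = trans (cong (λ a → m z j + a * m v j + δ u j * m z v + a * δ u j * m v v) (δ-≢ u≢z))
      (drop (m z j) (m v j) (δ u j) (m z v) (m v v))
      where
      drop : ∀ w x b y c → w + 0ℚ * x + b * y + 0ℚ * b * c ≡ w + b * y
      drop = solve-∀ ℚ-ring

    d⁺≡d : d⁺ ≡ d
    d⁺≡d = ∑-cong (All.universal m⁺z us)

    -- The new edge does not touch `z`, so adding it commutes with the elimination of `z`.
    mesh⁺ : ∀ i j → starMesh z d m⁺ i j ≡ (link u v ⊕ m′) i j
    mesh⁺ i j = trans (cong₂ (λ x y → m⁺ i j + x * y * inv d) (m⁺z i) (m⁺z j))
      (ℚ.+-assoc (link u v i j) (m i j) (m z i * m z j * inv d))

    d₀≡d : d₀ ≡ d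
    d₀≡d = begin
      ∑ (m₀ z) (ws ++ u ∷ [])                      ≡⟨ ∑-++ (m₀ z) ws (u ∷ []) ⟩
      ∑ (m₀ z) ws + (m₀ z u + 0ℚ)                  ≡⟨ cong₂ (λ x y → x + (y + 0ℚ)) (∑-cong (All.map away u∉)) at-u ⟩
      ∑ (m z) ws + (m z u + m z v + 0ℚ)            ≡⟨ cong (∑ (m z) ws +_) (ℚ.+-assoc (m z u) (m z v) 0ℚ) ⟩
      ∑ (m z) ws + (m z u + (m z v + 0ℚ))          ≡⟨ ∑-++ (m z) ws (u ∷ v ∷ []) ⟨
      ∑ (m z) (ws ++ u ∷ v ∷ [])                   ∎
      where
      away : ∀ {j} → u ≢ j → m₀ z j ≡ m z j
      away {j} u≢j = trans (m₀z j) (trans (cong (λ x → m z j + x * m z v) (δ-≢ u≢j)) (drop (m z j) (m z v)))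
        where
        drop : ∀ x y → x + 0ℚ * y ≡ x
        drop = solve-∀ ℚ-ring
      at-u : m₀ z u ≡ m z u + m z v
      at-u = trans (m₀z u) (cong (m z u +_) (trans (cong (_* m z v) (δ-≡ u)) (ℚ.*-identityˡ (m z v))))

    -- Contraction acts on the row of `z` by the same linear substitution as on each index of `m`,
    -- so it commutes with the elimination of `z`.
    mesh₀ : ∀ i j → starMesh z d m₀ i j ≡ contract u v m′ i j
    mesh₀ i j = trans (cong₂ (λ x y → m₀ i j + x * y * inv d) (m₀z i) (m₀z j))
      (commute (m i j) (m v j) (m i v) (m v v) (δ u i) (δ u j) (m z i) (m z j) (m z v) (inv d))
      where
      commute : ∀ w x y c a b p q r I →
        w + a * x + b * y + a * b * c + (p + a * r) * (q + b * r) * I ≡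
        w + p * q * I + a * (x + r * q * I) + b * (y + p * r * I) + a * b * (c + r * r * I)
      commute = solve-∀ ℚ-ring

  deletion-contraction : ∀ {u v ws m} → Unique (u ∷ v ∷ ws) → IsGraph m →
    treeSum (u ∷ v ∷ ws) (link u v ⊕ m) ≡ treeSum (u ∷ v ∷ ws) m + treeSum (u ∷ ws) (contract u v m)
  deletion-contraction {u} {v} {ws} {m} ((u≢v ∷ u∉) ∷ v∉ ∷ _) G = begin
    treeSum (u ∷ v ∷ ws) (link u v ⊕ m)
      ≡⟨ treeSum-↭ (++-comm (u ∷ v ∷ []) ws) (⊕-isGraph (link-isGraph u v) G) ⟩
    treeSum (ws ++ u ∷ v ∷ []) (link u v ⊕ m)
      ≡⟨ deletion-contraction-last u≢v ws u∉ v∉ m ⟩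
    treeSum (ws ++ u ∷ v ∷ []) m + treeSum (ws ++ u ∷ []) (contract u v m)
      ≡⟨ cong₂ _+_ (treeSum-↭ (++-comm (u ∷ v ∷ []) ws) G)
                   (treeSum-↭ (++-comm (u ∷ []) ws) (contract-isGraph u v G)) ⟨
    treeSum (u ∷ v ∷ ws) m + treeSum (u ∷ ws) (contract u v m) ∎
    where open ≡-Reasoning

-- Counting by Kruskal's algorithm

fromℕ : ℕ → ℚ
fromℕ zero    = 0ℚ
fromℕ (suc k) = 1ℚ + fromℕ k

fromℕ-+ : ∀ a b → fromℕ (a ℕ.+ b) ≡ fromℕ a + fromℕ b
fromℕ-+ zero    b = sym (ℚ.+-identityˡ (fromℕ b))
fromℕ-+ (suc a) b = trans (cong (1ℚ +_) (fromℕ-+ a b)) (sym (ℚ.+-assoc 1ℚ (fromℕ a) (fromℕ b)))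

fromℕ-* : ∀ a b → fromℕ (a ℕ.* b) ≡ fromℕ a * fromℕ b
fromℕ-* zero    b = sym (ℚ.*-zeroˡ (fromℕ b))
fromℕ-* (suc a) b = begin
  fromℕ (b ℕ.+ a ℕ.* b)            ≡⟨ fromℕ-+ b (a ℕ.* b) ⟩
  fromℕ b + fromℕ (a ℕ.* b)        ≡⟨ cong₂ _+_ (sym (ℚ.*-identityˡ (fromℕ b))) (fromℕ-* a b) ⟩
  1ℚ * fromℕ b + fromℕ a * fromℕ b ≡⟨ ℚ.*-distribʳ-+ (fromℕ b) 1ℚ (fromℕ a) ⟨
  (1ℚ + fromℕ a) * fromℕ b         ∎
  where open ≡-Reasoning

fromℕ-nonNeg : ∀ a → 0ℚ ≤ fromℕ a
fromℕ-nonNeg zero    = ℚ.≤-refl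
fromℕ-nonNeg (suc a) = +-nonNeg (ℚ.nonNegative⁻¹ 1ℚ) (fromℕ-nonNeg a)

fromℕ-pos : ∀ {a} → 1 ℕ.≤ a → 0ℚ < fromℕ a
fromℕ-pos {suc a} _ = subst (0ℚ <_) (ℚ.+-comm (fromℕ a) 1ℚ) (nonNeg+pos (fromℕ-nonNeg a) (ℚ.positive⁻¹ 1ℚ))

fromℕ-injective : ∀ {a b} → fromℕ a ≡ fromℕ b → a ≡ b
fromℕ-injective {zero}  {zero}  eq = refl
fromℕ-injective {zero}  {suc b} eq = contradiction eq (ℚ.<⇒≢ (fromℕ-pos {suc b} (ℕ.s≤s ℕ.z≤n)))
fromℕ-injective {suc a} {zero}  eq = contradiction (sym eq) (ℚ.<⇒≢ (fromℕ-pos {suc a} (ℕ.s≤s ℕ.z≤n)))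
fromℕ-injective {suc a} {suc b} eq = cong suc (fromℕ-injective (begin
  fromℕ a                   ≡⟨ cancel (fromℕ a) ⟩
  1ℚ + fromℕ a - 1ℚ         ≡⟨ cong (_- 1ℚ) eq ⟩
  1ℚ + fromℕ b - 1ℚ         ≡⟨ cancel (fromℕ b) ⟨
  fromℕ b                   ∎))
  where
  open ≡-Reasoning
  cancel : ∀ x → x ≡ 1ℚ + x - 1ℚ
  cancel = solve-∀ ℚ-ring

fromℕ-product : ∀ {A : Set} (f : A → ℕ) xs → fromℕ (product (map f xs)) ≡ ∏ (fromℕ ∘ f) xs
fromℕ-product f []       = refl
fromℕ-product f (x ∷ xs) = trans (fromℕ-* (f x) (product (map f xs))) (cong (fromℕ (f x) *_) (fromℕ-product f xs))

count : ∀ {A : Set} {P : A → Set} → Decidable P → List A → ℕ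
count P? = length ∘ filter P?

count-++ : ∀ {A : Set} {P : A → Set} (P? : Decidable P) xs ys → count P? (xs ++ ys) ≡ count P? xs ℕ.+ count P? ys
count-++ P? xs ys = trans (cong length (filter-++ P? xs ys)) (length-++ (filter P? xs))

count-map : ∀ {A B : Set} {P : B → Set} (P? : Decidable P) (f : A → B) xs →
            count P? (map f xs) ≡ count (P? ∘ f) xs
count-map P? f []       = refl
count-map P? f (x ∷ xs) with does (P? (f x))
... | true  = cong suc (count-map P? f xs)
... | false = count-map P? f xs

extract : ∀ {A : Set} {u v : A} {vs} → u ∈ vs → v ∈ vs → u ≢ v → ∃ λ ws → vs ↭ u ∷ v ∷ ws
extract {u = u} {v} u∈vs v∈vs u≢v with ∈-∃++ u∈vs
... | xs , ys , refl with ∈-resp-↭ (shift u xs ys) v∈vs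
...   | here v≡u = contradiction (sym v≡u) u≢v
...   | there v∈ with ∈-∃++ v∈
...     | xs′ , ys′ , eq = xs′ ++ ys′ , ↭-trans (shift u xs ys)
            (prep u (subst (_↭ v ∷ xs′ ++ ys′) (sym eq) (shift v xs′ ys′)))

module _ {n : ℕ} where

  merge : (Fin n → Fin n) → Fin n → Fin n → Fin n → Fin n
  merge φ u v x with φ x ≟ v
  ... | yes _ = u
  ... | no  _ = φ x

  merge-≡ : ∀ φ {u v x} → φ x ≡ v → merge φ u v x ≡ u
  merge-≡ φ {u} {v} {x} eq with φ x ≟ v
  ... | yes _  = refl
  ... | no neq = contradiction eq neq

  merge-≢ : ∀ φ {u v x} → φ x ≢ v → merge φ u v x ≡ φ x
  merge-≢ φ {u} {v} {x} neq with φ x ≟ v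
  ... | yes eq = contradiction eq neq
  ... | no _   = refl

  -- Kruskal's test: the classes of φ are the current components, and every chosen edge
  -- has to join two different components, until only one is left.
  Completes : ∀ {m} → (Fin n → Fin n) → (Fin m → Fin n × Fin n) → Subset m → Set
  Completes φ ends []            = ∀ x y → φ x ≡ φ y
  Completes φ ends (outside ∷ S) = Completes φ (ends ∘ suc) S
  Completes φ ends (inside ∷ S)  = let a , b = ends zero in
    φ a ≢ φ b × Completes (merge φ (φ a) (φ b)) (ends ∘ suc) S

  completes? : ∀ {m} φ (ends : Fin m → Fin n × Fin n) → Decidable (Completes φ ends)
  completes? φ ends []            = all? λ x → all? λ y → φ x ≟ φ y
  completes? φ ends (outside ∷ S) = completes? φ (ends ∘ suc) S
  completes? φ ends (inside ∷ S)  = let a , b = ends zero in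
    ¬? (φ a ≟ φ b) ×-dec completes? (merge φ (φ a) (φ b)) (ends ∘ suc) S

  -- The adjacency matrix of the remaining edges on the classes of `φ`; an edge inside one class
  -- contributes only to the diagonal.
  weight : ∀ {m} → (Fin n → Fin n) → (Fin m → Fin n × Fin n) → Weights (Fin n)
  weight {zero}  φ ends i j = 0ℚ
  weight {suc m} φ ends = let a , b = ends zero in
    _⊕_ _≟_ (link _≟_ (φ a) (φ b)) (weight φ (ends ∘ suc))

  weight-isGraph : ∀ {m} φ (ends : Fin m → Fin n × Fin n) → IsGraph (weight φ ends)
  weight-isGraph {zero}  φ ends = record { undirected = λ _ _ → refl ; nonneg = λ _ _ → ℚ.≤-refl }
  weight-isGraph {suc m} φ ends = ⊕-isGraph _≟_ (link-isGraph _≟_ (φ (proj₁ (ends zero))) (φ (proj₂ (ends zero)))) (weight-isGraph φ (ends ∘ suc))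

  δ-merge : ∀ φ {u v k} → k ≢ v → ∀ x → δ _≟_ (merge φ u v x) k ≡ δ _≟_ (φ x) k + δ _≟_ u k * δ _≟_ (φ x) v
  δ-merge φ {u} {v} {k} k≢v x with φ x ≟ v
  ... | yes refl = sym (trans (cong₂ (λ a b → a + δ _≟_ u k * b) (δ-≢ _≟_ (≢-sym k≢v)) (refl {x = 1ℚ}))
                     (identity (δ _≟_ u k)))
    where
    identity : ∀ a → 0ℚ + a * 1ℚ ≡ a
    identity = solve-∀ ℚ-ring
  ... | no φx≢v = sym (identity (δ _≟_ (φ x) k) (δ _≟_ u k))
    where
    identity : ∀ a b → a + b * 0ℚ ≡ a
    identity = solve-∀ ℚ-ring

  -- Each link is bilinear in the indicator vectors of its two end labels, and by `δ-merge` merging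
  -- adds the `v` coordinate of such a vector to its `u` coordinate. Label `v` itself is excluded:
  -- merging retires it, whereas `contract` leaves its row untouched.
  weight-merge : ∀ {m} φ (ends : Fin m → Fin n × Fin n) {u v i j} → i ≢ v → j ≢ v →
                 weight (merge φ u v) ends i j ≡ contract _≟_ u v (weight φ ends) i j
  weight-merge {zero} φ ends {u} {v} {i} {j} i≢v j≢v = sym (vanish (δ _≟_ u i) (δ _≟_ u j))
    where
    vanish : ∀ a b → 0ℚ + a * 0ℚ + b * 0ℚ + a * b * 0ℚ ≡ 0ℚ
    vanish = solve-∀ ℚ-ring
  weight-merge {suc m} φ ends {u} {v} {i} {j} i≢v j≢v = trans
    (cong₂ _+_ (cong₂ _+_ (cong₂ _*_ (δ-merge φ i≢v a) (δ-merge φ j≢v b))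
                          (cong₂ _*_ (δ-merge φ j≢v a) (δ-merge φ i≢v b)))
               (weight-merge φ (ends ∘ suc) i≢v j≢v))
    (bilinear (δ _≟_ (φ a) i) (δ _≟_ (φ a) j) (δ _≟_ (φ a) v) (δ _≟_ (φ b) i) (δ _≟_ (φ b) j) (δ _≟_ (φ b) v)
              (δ _≟_ u i) (δ _≟_ u j) (W i j) (W v j) (W i v) (W v v))
    where
    a = proj₁ (ends zero)
    b = proj₂ (ends zero)
    W = weight φ (ends ∘ suc)
    bilinear : ∀ aᵢ aⱼ aᵥ bᵢ bⱼ bᵥ uᵢ uⱼ w x y z →
      (aᵢ + uᵢ * aᵥ) * (bⱼ + uⱼ * bᵥ) + (aⱼ + uⱼ * aᵥ) * (bᵢ + uᵢ * bᵥ) + (w + uᵢ * x + uⱼ * y + uᵢ * uⱼ * z) ≡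
      aᵢ * bⱼ + aⱼ * bᵢ + w + uᵢ * (aᵥ * bⱼ + aⱼ * bᵥ + x) + uⱼ * (aᵢ * bᵥ + aᵥ * bᵢ + y) + uᵢ * uⱼ * (aᵥ * bᵥ + aᵥ * bᵥ + z)
    bilinear = solve-∀ ℚ-ring

  -- The list enumerates the labels in use, each once. With `surjective`, two entries of the list
  -- certify two distinct components.
  record Represents (vs : List (Fin n)) (φ : Fin n → Fin n) : Set where
    field
      unique     : Unique vs
      label∈     : ∀ x → φ x ∈ vs
      surjective : ∀ {v} → v ∈ vs → ∃ λ x → φ x ≡ v

  open Represents

  represents-↭ : ∀ {us vs φ} → us ↭ vs → Represents us φ → Represents vs φ
  represents-↭ p R .unique       = Unique-resp-↭ (setoid _) (↭⇒↭ₛ p) (unique R)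
  represents-↭ p R .label∈ x     = ∈-resp-↭ p (label∈ R x)
  represents-↭ p R .surjective v∈ = surjective R (∈-resp-↭ (↭-sym p) v∈)

  represents-merge : ∀ {u v ws φ} → Represents (u ∷ v ∷ ws) φ → Represents (u ∷ ws) (merge φ u v)
  represents-merge R .unique with unique R
  ... | (_ ∷ u∉) ∷ _ ∷ un = u∉ ∷ un
  represents-merge {u} {v} {ws} {φ} R .label∈ x with φ x ≟ v | label∈ R x
  ... | yes _   | _              = here refl
  ... | no _    | here eq        = here eq
  ... | no φx≢v | there (here eq) = contradiction eq φx≢v
  ... | no _    | there (there φx∈) = there φx∈
  represents-merge {u} {v} {ws} {φ} R .surjective {w} w∈ with unique R
  ... | (u≢v ∷ _) ∷ v∉ ∷ _ = x , trans (merge-≢ φ φx≢v) φx≡w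
    where
    w≢v : ∀ {w} → w ∈ u ∷ ws → w ≢ v
    w≢v (here refl)  = u≢v
    w≢v (there w∈ws) = ≢-sym (All.lookup v∉ w∈ws)
    old : ∀ {w} → w ∈ u ∷ ws → w ∈ u ∷ v ∷ ws
    old (here eq)    = here eq
    old (there w∈ws) = there (there w∈ws)
    x = proj₁ (surjective R (old w∈))
    φx≡w = proj₂ (surjective R (old w∈))
    φx≢v : φ x ≢ v
    φx≢v eq = w≢v w∈ (trans (sym φx≡w) eq)

  -- Only the empty set of edges is left, and it completes when there is at most one class. Those
  -- are the lists on which `treeSum` is 1, the empty list included; on a longer list the head is
  -- isolated and its degree 0 kills the product.
  treeSum-empty : ∀ {φ} (ends : Fin 0 → Fin n × Fin n) vs → Represents vs φ →
                  fromℕ (count (completes? φ ends) (allSubsets 0)) ≡ treeSum vs (weight φ ends)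
  treeSum-empty {φ} ends vs R = by-cases vs R (completes? φ ends [])
    where
    accept : Completes φ ends [] → fromℕ (count (completes? φ ends) (allSubsets 0)) ≡ 1ℚ
    accept c = cong (fromℕ ∘ length) (filter-accept (completes? φ ends) {x = []} {xs = []} c)
    reject : ¬ Completes φ ends [] → fromℕ (count (completes? φ ends) (allSubsets 0)) ≡ 0ℚ
    reject ¬c = cong (fromℕ ∘ length) (filter-reject (completes? φ ends) {x = []} {xs = []} ¬c)

    isolated : ∀ u vs x → ∑ (weight φ ends u) vs * x ≡ 0ℚ
    isolated u vs x = trans (cong (_* x) (∑-zero vs)) (ℚ.*-zeroˡ x)

    by-cases : ∀ vs → Represents vs φ → Dec (Completes φ ends []) →
               fromℕ (count (completes? φ ends) (allSubsets 0)) ≡ treeSum vs (weight φ ends)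
    by-cases []           R _ = accept λ x y → contradiction (label∈ R x) λ ()
    by-cases (v ∷ [])     R _ = accept λ x y → trans (only (label∈ R x)) (sym (only (label∈ R y)))
      where
      only : ∀ {w} → w ∈ v ∷ [] → w ≡ v
      only (here eq) = eq
    by-cases (u ∷ v ∷ vs) R (yes constant) with unique R
    ... | (u≢v ∷ _) ∷ _ = contradiction
      (trans (sym (proj₂ x)) (trans (constant (proj₁ x) (proj₁ y)) (proj₂ y))) u≢v
      where
      x = surjective R (here refl)
      y = surjective R (there (here refl))
    by-cases (u ∷ v ∷ vs) R (no nonconstant) =
      trans (reject nonconstant) (sym (isolated u (v ∷ vs) _))

  -- Induction on the edges: the sets without the first edge count deletion, those with it count
  -- contraction.
  count-completes : ∀ m {φ} (ends : Fin m → Fin n × Fin n) vs → Represents vs φ →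
                    fromℕ (count (completes? φ ends) (allSubsets m)) ≡ treeSum vs (weight φ ends)
  count-completes zero ends vs R = treeSum-empty ends vs R
  count-completes (suc m) {φ} ends vs R = begin
    fromℕ (count (completes? φ ends) (allSubsets (suc m)))
      ≡⟨ cong fromℕ (trans (count-++ (completes? φ ends) (map (outside ∷_) (allSubsets m)) (map (inside ∷_) (allSubsets m)))
           (cong₂ ℕ._+_ (count-map (completes? φ ends) (outside ∷_) (allSubsets m))
                        (count-map (completes? φ ends) (inside ∷_) (allSubsets m)))) ⟩
    fromℕ (excluded ℕ.+ included)         ≡⟨ fromℕ-+ excluded included ⟩
    fromℕ excluded + fromℕ included       ≡⟨ cong (_+ fromℕ included) (count-completes m ends′ vs R) ⟩
    treeSum vs W + fromℕ included        ≡⟨ by-cases (φ a ≟ φ b) ⟩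
    treeSum vs (weight φ ends)        ∎
    where
    open ≡-Reasoning
    a = proj₁ (ends zero)
    b = proj₂ (ends zero)
    ends′ = ends ∘ suc
    W = weight φ ends′
    φ′ = merge φ (φ a) (φ b)
    excluded = count (λ S → completes? φ ends (outside ∷ S)) (allSubsets m)
    included = count (λ S → completes? φ ends (inside ∷ S)) (allSubsets m)

    by-cases : Dec (φ a ≡ φ b) → treeSum vs W + fromℕ included ≡ treeSum vs (weight φ ends)
    -- The edge has become a loop: no completing set takes it, and its weight lies on the diagonal.
    by-cases (yes φa≡φb) = begin
      treeSum vs W + fromℕ included   ≡⟨ cong (λ k → treeSum vs W + fromℕ k) none ⟩
      treeSum vs W + 0ℚ            ≡⟨ ℚ.+-identityʳ (treeSum vs W) ⟩
      treeSum vs W                 ≡⟨ treeSum-cong (unique⇒allPairs (unique R) λ {i} {j} _ _ i≢j → sym (loop i j i≢j)) ⟩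
      treeSum vs (weight φ ends)   ∎
      where
      none : included ≡ 0
      none = cong length (filter-none (λ S → completes? φ ends (inside ∷ S))
        (All.universal (λ S (φa≢φb , _) → φa≢φb φa≡φb) (allSubsets m)))
      loop : ∀ i j → i ≢ j → link _≟_ (φ a) (φ b) i j + W i j ≡ W i j
      loop i j i≢j = trans (cong (_+ W i j) (trans
        (cong (λ w → δ _≟_ (φ a) i * δ _≟_ w j + δ _≟_ (φ a) j * δ _≟_ w i) (sym φa≡φb))
        (cong₂ _+_ (δ-disjoint _≟_ (φ a) i≢j) (δ-disjoint _≟_ (φ a) (≢-sym i≢j))))) (ℚ.+-identityˡ (W i j))
    -- The two labels are moved to the front so that contraction drops `φ b`, the label that `merge`
    -- retires.
    by-cases (no φa≢φb) = begin
      treeSum vs W + fromℕ included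
        ≡⟨ cong₂ (λ x k → x + fromℕ k) (treeSum-↭ p (weight-isGraph φ ends′)) only-rest ⟩
      treeSum us W + fromℕ (count (completes? φ′ ends′) (allSubsets m))
        ≡⟨ cong (treeSum us W +_) (count-completes m ends′ (φ a ∷ ws) (represents-merge R′)) ⟩
      treeSum us W + treeSum (φ a ∷ ws) (weight φ′ ends′)
        ≡⟨ cong (treeSum us W +_) (treeSum-cong (unique⇒allPairs (unique (represents-merge R′))
             λ i∈ j∈ _ → weight-merge φ ends′ (≢b i∈) (≢b j∈))) ⟩
      treeSum us W + treeSum (φ a ∷ ws) (contract _≟_ (φ a) (φ b) W)
        ≡⟨ deletion-contraction _≟_ (unique R′) (weight-isGraph φ ends′) ⟨
      treeSum us (weight φ ends)
        ≡⟨ treeSum-↭ p (weight-isGraph φ ends) ⟨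
      treeSum vs (weight φ ends) ∎
      where
      extraction = extract (label∈ R a) (label∈ R b) φa≢φb
      ws = proj₁ extraction
      us = φ a ∷ φ b ∷ ws
      p : vs ↭ us
      p = proj₂ extraction
      R′ : Represents us φ
      R′ = represents-↭ p R
      only-rest : included ≡ count (completes? φ′ ends′) (allSubsets m)
      only-rest = cong length (filter-≐ (λ S → completes? φ ends (inside ∷ S)) (completes? φ′ ends′)
        (proj₂ , (φa≢φb ,_)) (allSubsets m))
      ≢b : ∀ {i} → i ∈ φ a ∷ ws → i ≢ φ b
      ≢b i∈ with unique R′ | i∈
      ... | _           | here refl = φa≢φb
      ... | _ ∷ b∉ ∷ _  | there i∈ws = ≢-sym (All.lookup b∉ i∈ws)

-- Kruskal's algorithm recognises spanning trees

module _ {n : ℕ} (G : Multigraph n) (S : Subset (Multigraph.size G)) where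
  open Multigraph G

  src tgt : Fin size → Fin n
  src e = proj₁ (ends e)
  tgt e = proj₂ (ends e)

  joins-sym : ∀ {e u v} → Joins G e u v → Joins G e v u
  joins-sym (inj₁ eq) = inj₂ eq
  joins-sym (inj₂ eq) = inj₁ eq

  joins-end : ∀ {e x y u v} → Joins G e x y → Joins G e u v → x ≡ u ⊎ x ≡ v
  joins-end (inj₁ eq) (inj₁ eq′) = inj₁ (cong proj₁ (trans (sym eq) eq′))
  joins-end (inj₁ eq) (inj₂ eq′) = inj₂ (cong proj₁ (trans (sym eq) eq′))
  joins-end (inj₂ eq) (inj₁ eq′) = inj₂ (cong proj₂ (trans (sym eq) eq′))
  joins-end (inj₂ eq) (inj₂ eq′) = inj₁ (cong proj₂ (trans (sym eq) eq′))

  Using : List (Fin size) → ∀ {u v} → Walk G S u v → Set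
  Using P p = All (_∈ P) (edges G S p)

  Reach : List (Fin size) → Fin n → Fin n → Set
  Reach P u v = Σ (Walk G S u v) (Using P)

  stay : ∀ {P u} → Reach P u u
  stay = [] , []

  _◅◅_ : ∀ {P u v w} → Reach P u v → Reach P v w → Reach P u w
  ([]            , [])       ◅◅ r = r
  (step e e∈ j p , e∈P ∷ ps) ◅◅ r = let q , qs = (p , ps) ◅◅ r in step e e∈ j q , e∈P ∷ qs

  single : ∀ {P e u v} → e ∈ₛ S → e ∈ P → Joins G e u v → Reach P u v
  single e∈S e∈P j = step _ e∈S j [] , e∈P ∷ []

  reverse : ∀ {P u v} → Reach P u v → Reach P v u
  reverse ([]             , [])       = stay
  reverse (step e e∈S j p , e∈P ∷ ps) = reverse (p , ps) ◅◅ single e∈S e∈P (joins-sym j)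

  weaken : ∀ {e P u v} → Reach P u v → Reach (e ∷ P) u v
  weaken (p , ps) = p , All.map there ps

  reach-respects : ∀ {P} (φ : Fin n → Fin n) → (∀ {e u v} → e ∈ₛ S → e ∈ P → Joins G e u v → φ u ≡ φ v) →
                   ∀ {u v} → Reach P u v → φ u ≡ φ v
  reach-respects φ r ([]             , [])       = refl
  reach-respects φ r (step e e∈S j p , e∈P ∷ ps) = trans (r e∈S e∈P j) (reach-respects φ r (p , ps))

  -- The list keeps the order of acceptance, latest edge first: each edge joined two different
  -- components of the edges accepted before it.
  data Forest : List (Fin size) → Set where
    []  : Forest []
    _∷_ : ∀ {e P} → ¬ Reach P (src e) (tgt e) → Forest P → Forest (e ∷ P)

  avoid : ∀ {e : Fin size} {P es} → All (_∈ e ∷ P) es → All (e ≢_) es → All (_∈ P) es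
  avoid []                []          = []
  avoid (here refl ∷ ∈s)  (e≢e ∷ ≢s)  = contradiction refl e≢e
  avoid (there f∈P ∷ ∈s)  (_ ∷ ≢s)    = f∈P ∷ avoid ∈s ≢s

  split : ∀ {e P u w} (p : Walk G S u w) → Using (e ∷ P) p → Unique (edges G S p) → e ∈ edges G S p →
          ∃₂ λ x y → Joins G e x y × Reach P u x × Reach P y w
  split (step f f∈S j p) (_ ∷ ps) (f∉ ∷ un) (here refl) = _ , _ , j , stay , (p , avoid ps f∉)
  split (step f f∈S j p) (here refl ∷ ps) (f∉ ∷ un) (there e∈) = contradiction refl (All.lookup f∉ e∈)
  split (step f f∈S j p) (there f∈P ∷ ps) (f∉ ∷ un) (there e∈) =
    let x , y , j′ , r , r′ = split p ps un e∈ in x , y , j′ , single f∈S f∈P j ◅◅ r , r′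

  -- If a closed trail used the latest edge `e`, opening it at `e` would leave a route between the
  -- ends of `e` through earlier edges. So `e` is absent and the smaller forest takes over.
  forest-closed : ∀ {P u} → Forest P → (p : Walk G S u u) → Using P p → Unique (edges G S p) → edges G S p ≡ []
  forest-closed [] []               _         _  = refl
  forest-closed [] (step _ _ _ _)   (() ∷ _)  _
  forest-closed {e ∷ P} (e-bridge ∷ forest) p ps un with DecMembership._∈?_ _≟_ e (edges G S p)
  ... | no e∉ = forest-closed forest p (avoid ps (¬Any⇒All¬ _ e∉)) un
  ... | yes e∈ with split p ps un e∈
  ...   | x , y , j , r , r′ = contradiction (orient j (reverse (r′ ◅◅ r))) e-bridge
    where
    orient : ∀ {x y} → Joins G e x y → Reach P x y → Reach P (src e) (tgt e)
    orient (inj₁ eq) r = subst (λ (a , b) → Reach P a b) (sym eq) r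
    orient (inj₂ eq) r = subst (λ (a , b) → Reach P a b) (sym eq) (reverse r)

  forest⇒acyclic : ∀ {P} → Forest P → (∀ {e} → e ∈ₛ S → e ∈ P) → Acyclic G S
  forest⇒acyclic {P} forest all∈P u p (nonempty , unique-edges , _) =
    nonempty (forest-closed forest p (uses p) unique-edges)
    where
    uses : ∀ {u v} (p : Walk G S u v) → Using P p
    uses []               = []
    uses (step e e∈S _ p) = all∈P e∈S ∷ uses p

  vertices : ∀ {u v} → Walk G S u v → List (Fin n)
  vertices {v = v} p = initVertices G S p ++ v ∷ []

  start∈ : ∀ {u v} (p : Walk G S u v) → u ∈ vertices p
  start∈ []             = here refl
  start∈ (step _ _ _ _) = here refl

  -- Unlike in `Path`, the final vertex must also differ from the others, so that a further edge
  -- from the end back to the start closes a cycle.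
  SimplePath : List (Fin size) → Fin n → Fin n → Set
  SimplePath P u v = Σ (Walk G S u v) λ p → Using P p × Unique (vertices p)

  suffix : ∀ {P u v w} ((p , _) : SimplePath P v w) → u ∈ vertices p → SimplePath P u w
  suffix r@([] , _)                              (here refl) = r
  suffix r@(step _ _ _ _ , _)                    (here refl) = r
  suffix (step _ _ _ p , (_ ∷ ps) , (_ ∷ un))    (there u∈)  = suffix (p , ps , un) u∈

  simplify : ∀ {P u v} → Reach P u v → SimplePath P u v
  simplify ([] , []) = [] , [] , ([] ∷ [])
  simplify {u = u} (step e e∈S j p , e∈P ∷ ps) with simplify (p , ps)
  ... | q , qs , un with DecMembership._∈?_ _≟_ u (vertices q)
  ...   | yes u∈ = suffix (q , qs , un) u∈
  ...   | no  u∉ = step e e∈S j q , (e∈P ∷ qs) , (¬Any⇒All¬ _ u∉ ∷ un)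

  end∈vertices : ∀ {e x y u v} (p : Walk G S u v) → e ∈ edges G S p → Joins G e x y → x ∈ vertices p
  end∈vertices (step e e∈S j p) (here refl) j′ with joins-end j′ j
  ... | inj₁ x≡u = here x≡u
  ... | inj₂ refl = there (start∈ p)
  end∈vertices (step e e∈S j p) (there e∈)  j′ = there (end∈vertices p e∈ j′)

  -- If the first edge occurred again, the starting vertex, being one of its ends, would be visited
  -- again.
  unique-edges : ∀ {u v} (p : Walk G S u v) → Unique (vertices p) → Unique (edges G S p)
  unique-edges []               _         = []
  unique-edges (step e e∈S j p) (u∉ ∷ un) =
    ¬Any⇒All¬ _ (λ e∈ → All¬⇒¬Any u∉ (end∈vertices p e∈ j)) ∷ unique-edges p un

  acyclic⇒bridge : ∀ {P e} → Acyclic G S → e ∈ₛ S → e ∉ P → ¬ Reach P (src e) (tgt e)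
  acyclic⇒bridge {P} {e} acyclic e∈S e∉P r with simplify (reverse r)
  ... | q , qs , un = acyclic (src e) (step e e∈S (inj₁ refl) q)
    ( (λ ())
    , (All.map (λ { f∈P refl → e∉P f∈P }) qs ∷ unique-edges q un)
    -- The closed walk lists `src e` at its start, while `vertices q` lists it at the end; the two
    -- lists are rotations of each other.
    , Unique-resp-↭ (setoid _) (↭⇒↭ₛ (++-comm (initVertices G S q) (src e ∷ []))) un)

  -- The invariant of the scan: `P` holds the accepted edges, `S′` is the unscanned part of `S`, `ι`
  -- embeds the unscanned indices into all edges, and the classes of `φ` are the components of `P`.
  record State {m} (φ : Fin n → Fin n) (ι : Fin m → Fin size) (S′ : Subset m) (P : List (Fin size)) : Set where
    field
      chosen    : ∀ {e} → e ∈ P → e ∈ₛ S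
      pending   : ∀ {e} → e ∈ₛ S′ → ι e ∈ₛ S
      covered   : ∀ {e} → e ∈ₛ S → e ∈ P ⊎ ∃ λ e′ → e′ ∈ₛ S′ × e ≡ ι e′
      fresh     : ∀ {e} → ι e ∉ P
      injective : ∀ {e e′} → ι e ≡ ι e′ → e ≡ e′
      sound     : ∀ {u v} → φ u ≡ φ v → Reach P u v
      complete  : ∀ {u v} → Reach P u v → φ u ≡ φ v

  open State

  skip : ∀ {m φ ι P} {S′ : Subset m} → State φ ι (outside ∷ S′) P → State φ (ι ∘ suc) S′ P
  skip s .chosen        = chosen s
  skip s .pending e∈    = pending s (there e∈)
  skip s .covered e∈ with covered s e∈
  ... | inj₁ e∈P                       = inj₁ e∈P
  ... | inj₂ (suc e′ , there e′∈ , eq) = inj₂ (e′ , e′∈ , eq)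
  skip s .fresh         = fresh s
  skip s .injective eq with injective s eq
  ... | refl = refl
  skip s .sound         = sound s
  skip s .complete      = complete s

  -- Merging the labels of the two ends matches adding the edge to `P`: equal new labels are
  -- connected by a detour over that edge, and conversely the new labelling is constant along every
  -- edge of the larger set.
  take : ∀ {m φ ι P} {S′ : Subset m} → State φ ι (inside ∷ S′) P →
         State (merge φ (φ (src (ι zero))) (φ (tgt (ι zero)))) (ι ∘ suc) S′ (ι zero ∷ P)
  take s .chosen (here refl) = pending s here
  take s .chosen (there e∈P) = chosen s e∈P
  take s .pending e∈         = pending s (there e∈)
  take s .covered e∈ with covered s e∈
  ... | inj₁ e∈P                       = inj₁ (there e∈P)
  ... | inj₂ (zero , here , eq)        = inj₁ (here eq)
  ... | inj₂ (suc e′ , there e′∈ , eq) = inj₂ (e′ , e′∈ , eq)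
  take s .fresh (here eq) with injective s eq
  ... | ()
  take s .fresh (there e∈)   = fresh s e∈
  take s .injective eq with injective s eq
  ... | refl = refl
  take {φ = φ} {ι} {P} s .sound {u} {v} = by-cases (φ u ≟ φ b) (φ v ≟ φ b)
    where
    a = src (ι zero)
    b = tgt (ι zero)
    bridge : Reach (ι zero ∷ P) b a
    bridge = single (pending s here) (here refl) (inj₂ refl)
    φ′ = merge φ (φ a) (φ b)
    by-cases : ∀ {u v} → Dec (φ u ≡ φ b) → Dec (φ v ≡ φ b) → φ′ u ≡ φ′ v → Reach (ι zero ∷ P) u v
    by-cases (yes u~b) (yes v~b) _  = weaken (sound s (trans u~b (sym v~b)))
    by-cases (yes u~b) (no v≁b)  eq = weaken (sound s u~b) ◅◅ (bridge ◅◅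
      weaken (sound s (trans (sym (merge-≡ φ u~b)) (trans eq (merge-≢ φ v≁b)))))
    by-cases (no u≁b)  (yes v~b) eq = weaken (sound s (trans (sym (merge-≢ φ u≁b)) (trans eq (merge-≡ φ v~b))))
      ◅◅ (reverse bridge ◅◅ weaken (sound s (sym v~b)))
    by-cases (no u≁b)  (no v≁b)  eq = weaken (sound s (trans (sym (merge-≢ φ u≁b)) (trans eq (merge-≢ φ v≁b))))
  take {φ = φ} {ι} {P} s .complete = reach-respects φ′ respects
    where
    a = src (ι zero)
    b = tgt (ι zero)
    φ′ = merge φ (φ a) (φ b)
    factors : ∀ {x y} → φ x ≡ φ y → φ′ x ≡ φ′ y
    factors {x} {y} eq with φ x ≟ φ b
    ... | yes x~b = sym (merge-≡ φ (trans (sym eq) x~b))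
    ... | no  x≁b = trans eq (sym (merge-≢ φ λ y~b → x≁b (trans eq y~b)))
    absorbed : φ′ a ≡ φ′ b
    absorbed with φ a ≟ φ b
    ... | yes _ = sym (merge-≡ φ refl)
    ... | no  _ = sym (merge-≡ φ refl)
    respects : ∀ {e u v} → e ∈ₛ S → e ∈ ι zero ∷ P → Joins G e u v → φ′ u ≡ φ′ v
    respects e∈S (here refl) (inj₁ eq) = subst (λ (x , y) → φ′ x ≡ φ′ y) eq absorbed
    respects e∈S (here refl) (inj₂ eq) = subst (λ (x , y) → φ′ y ≡ φ′ x) eq (sym absorbed)
    respects e∈S (there e∈P) j         = factors (complete s (single e∈S e∈P j))

  completes⇒spanningTree : ∀ {m φ ι P} (S′ : Subset m) → State φ ι S′ P → Forest P →
                           Completes φ (ends ∘ ι) S′ → IsSpanningTree G S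
  completes⇒spanningTree []             s forest c = (λ u v → proj₁ (sound s (c u v))) , forest⇒acyclic forest all∈P
    where
    all∈P : ∀ {e} → e ∈ₛ S → e ∈ _
    all∈P e∈S with covered s e∈S
    ... | inj₁ e∈P = e∈P
    ... | inj₂ (() , _)
  completes⇒spanningTree (outside ∷ S′) s forest c       = completes⇒spanningTree S′ (skip s) forest c
  completes⇒spanningTree (inside ∷ S′)  s forest (a≁b , c) =
    completes⇒spanningTree S′ (take s) ((λ r → a≁b (complete s r)) ∷ forest) c

  spanningTree⇒completes : ∀ {m φ ι P} (S′ : Subset m) → State φ ι S′ P →
                           IsSpanningTree G S → Completes φ (ends ∘ ι) S′
  spanningTree⇒completes {P = P} [] s (connected , _) x y = complete s (connected x y , uses (connected x y))
    where
    uses : ∀ {u v} (p : Walk G S u v) → Using P p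
    uses []               = []
    uses (step e e∈S _ p) with covered s e∈S
    ... | inj₁ e∈P = e∈P ∷ uses p
    ... | inj₂ (() , _)
  spanningTree⇒completes (outside ∷ S′) s tree = spanningTree⇒completes S′ (skip s) tree
  spanningTree⇒completes (inside ∷ S′)  s tree =
    (λ a~b → acyclic⇒bridge (proj₂ tree) (pending s here) (fresh s) (sound s a~b)) ,
    spanningTree⇒completes S′ (take s) tree

  initial : State id id S []
  initial .chosen ()
  initial .pending e∈  = e∈
  initial .covered e∈  = inj₂ (_ , e∈ , refl)
  initial .fresh ()
  initial .injective   = id
  initial .sound refl  = stay
  initial .complete ([] , _) = refl
  initial .complete (step _ _ _ _ , () ∷ _)

  completes⇔spanningTree : Completes id ends S ⇔ IsSpanningTree G S
  completes⇔spanningTree = mk⇔ (completes⇒spanningTree S initial []) (spanningTree⇒completes S initial)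

-- The multigraph

∑-one : ∀ {A : Set} (xs : List A) → ∑ (λ _ → 1ℚ) xs ≡ fromℕ (length xs)
∑-one []       = refl
∑-one (_ ∷ xs) = cong (1ℚ +_) (∑-one xs)

count-∷ : ∀ {A : Set} {P : A → Set} (P? : Decidable P) {x q} → (P x → q ≡ 1ℚ) → (¬ P x → q ≡ 0ℚ) →
          ∀ xs → fromℕ (count P? (x ∷ xs)) ≡ q + fromℕ (count P? xs)
count-∷ P? {x} p ¬p xs with P? x
... | yes px = cong (_+ fromℕ (count P? xs)) (sym (p px))
... | no ¬px = sym (trans (cong (_+ fromℕ (count P? xs)) (¬p ¬px)) (ℚ.+-identityˡ _))

allPairs⇒ : ∀ {A : Set} {R : A → A → Set} → Symmetric R → ∀ {xs} → AllPairs R xs →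
            ∀ {x y} → x ∈ xs → y ∈ xs → x ≢ y → R x y
allPairs⇒ R-sym (_ ∷ _)   (here refl) (here refl) x≢y = contradiction refl x≢y
allPairs⇒ R-sym (rs ∷ _)  (here refl) (there y∈)  x≢y = All.lookup rs y∈
allPairs⇒ R-sym (rs ∷ _)  (there x∈)  (here refl) x≢y = R-sym (All.lookup rs x∈)
allPairs⇒ R-sym (_ ∷ rss) (there x∈)  (there y∈)  x≢y = allPairs⇒ R-sym rss x∈ y∈ x≢y

module _ {n : ℕ} where

  private
    δₙ : Fin n → Fin n → ℚ
    δₙ = δ _≟_

  ∑-δ : ∀ {v vs} → Unique vs → v ∈ vs → ∑ (δₙ v) vs ≡ 1ℚ
  ∑-δ {v} (v∉ ∷ _) (here {xs = vs} refl) = trans (cong₂ _+_ (δ-≡ _≟_ v)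
    (trans (∑-cong (All.map (δ-≢ _≟_) v∉)) (∑-zero vs))) (ℚ.+-identityʳ 1ℚ)
  ∑-δ (u∉ ∷ un) (there {xs = vs} v∈) = trans
    (cong₂ _+_ (δ-≢ _≟_ (≢-sym (All.lookup u∉ v∈))) (∑-δ un v∈)) (ℚ.+-identityˡ 1ℚ)

  deg-⊕ : ∀ vs (m m′ : Weights (Fin n)) v → deg vs (_⊕_ _≟_ m m′) v ≡ deg vs m v + deg vs m′ v
  deg-⊕ vs m m′ v = trans (cong (_- (m v v + m′ v v)) (∑-+ (m v) (m′ v) vs))
    (regroup (∑ (m v) vs) (∑ (m′ v) vs) (m v v) (m′ v v))
    where
    regroup : ∀ a b c d → a + b - (c + d) ≡ a - c + (b - d)
    regroup = solve-∀ ℚ-ring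

  deg-link : ∀ {a b} → a ≢ b → ∀ v → deg (allFin n) (link _≟_ a b) v ≡ δₙ a v + δₙ b v
  deg-link {a} {b} a≢b v = begin
    ∑ (λ j → δₙ a v * δₙ b j + δₙ a j * δₙ b v) vs - (δₙ a v * δₙ b v + δₙ a v * δₙ b v)
      ≡⟨ cong₂ _-_ total (cong₂ _+_ common common) ⟩
    δₙ a v + δₙ b v - (0ℚ + 0ℚ)
      ≡⟨ finish (δₙ a v + δₙ b v) ⟩
    δₙ a v + δₙ b v ∎
    where
    open ≡-Reasoning
    vs = allFin n
    finish : ∀ x → x - (0ℚ + 0ℚ) ≡ x
    finish = solve-∀ ℚ-ring
    common : δₙ a v * δₙ b v ≡ 0ℚ
    common = trans (cong₂ _*_ (δ-sym _≟_ a v) (δ-sym _≟_ b v)) (δ-disjoint _≟_ v a≢b)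
    ∑-scaled-δ : ∀ u x → ∑ (λ j → δₙ u j * x) vs ≡ x
    ∑-scaled-δ u x = trans (∑-* (δₙ u) x vs) (trans (cong (_* x) (∑-δ (allFin⁺ n) (∈-allFin u))) (ℚ.*-identityˡ x))
    total : ∑ (λ j → δₙ a v * δₙ b j + δₙ a j * δₙ b v) vs ≡ δₙ a v + δₙ b v
    total = begin
      ∑ (λ j → δₙ a v * δₙ b j + δₙ a j * δₙ b v) vs
        ≡⟨ ∑-+ _ _ vs ⟩
      ∑ (λ j → δₙ a v * δₙ b j) vs + ∑ (λ j → δₙ a j * δₙ b v) vs
        ≡⟨ cong₂ _+_ (trans (∑-cong (All.universal (λ j → ℚ.*-comm (δₙ a v) (δₙ b j)) vs)) (∑-scaled-δ b (δₙ a v)))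
                     (∑-scaled-δ a (δₙ b v)) ⟩
      δₙ a v + δₙ b v ∎

module _ {n : ℕ} (G : Multigraph n) where
  open Multigraph G

  private
    vs : List (Fin n)
    vs = allFin n
    W : Weights (Fin n)
    W = weight id ends

  link-joined : ∀ {e i j} → i ≢ j → Joins G e i j → link _≟_ (proj₁ (ends e)) (proj₂ (ends e)) i j ≡ 1ℚ
  link-joined {e} {i} {j} i≢j (inj₁ eq) = trans (cong (λ (a , b) → link _≟_ a b i j) eq)
    (cong₂ _+_ (cong₂ _*_ (δ-≡ _≟_ i) (δ-≡ _≟_ j)) (cong₂ _*_ (δ-≢ _≟_ i≢j) (δ-≢ _≟_ (≢-sym i≢j))))
  link-joined {e} {i} {j} i≢j (inj₂ eq) = trans (cong (λ (a , b) → link _≟_ a b i j) eq)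
    (cong₂ _+_ (cong₂ _*_ (δ-≢ _≟_ (≢-sym i≢j)) (δ-≢ _≟_ i≢j)) (cong₂ _*_ (δ-≡ _≟_ j) (δ-≡ _≟_ i)))

  link-unjoined : ∀ {e i j} → ¬ Joins G e i j → link _≟_ (proj₁ (ends e)) (proj₂ (ends e)) i j ≡ 0ℚ
  link-unjoined {e} {i} {j} ¬joins = cong₂ _+_
    (vanish i j λ a≡i b≡j → ¬joins (inj₁ (cong₂ _,_ a≡i b≡j)))
    (vanish j i λ a≡j b≡i → ¬joins (inj₂ (cong₂ _,_ a≡j b≡i)))
    where
    vanish : ∀ x y → (proj₁ (ends e) ≡ x → proj₂ (ends e) ≢ y) → δ _≟_ (proj₁ (ends e)) x * δ _≟_ (proj₂ (ends e)) y ≡ 0ℚ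
    vanish x y imp with proj₁ (ends e) ≟ x
    ... | yes a≡x = trans (cong (1ℚ *_) (δ-≢ _≟_ (imp a≡x))) (ℚ.*-zeroʳ 1ℚ)
    ... | no _    = ℚ.*-zeroˡ (δ _≟_ (proj₂ (ends e)) y)

  weight-multiplicity : ∀ {i j} → i ≢ j → W i j ≡ fromℕ (multiplicity G i j)
  weight-multiplicity {i} {j} i≢j = go id
    where
    go : ∀ {m} (f : Fin m → Fin size) →
         weight id (ends ∘ f) i j ≡ fromℕ (count (λ e → joins? G e i j) (tabulate f))
    go {zero}  f = refl
    go {suc m} f = trans (cong (link _≟_ (proj₁ (ends (f zero))) (proj₂ (ends (f zero))) i j +_) (go (f ∘ suc)))
      (sym (count-∷ (λ e → joins? G e i j) (link-joined {f zero} i≢j) (link-unjoined {f zero}) (tabulate (f ∘ suc))))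

  deg-weight : ∀ v → deg vs W v ≡ fromℕ (degree G v)
  deg-weight v = go id
    where
    incident : ∀ e → Incident G v e → δ _≟_ (proj₁ (ends e)) v + δ _≟_ (proj₂ (ends e)) v ≡ 1ℚ
    incident e (inj₁ refl) = cong₂ _+_ (δ-≡ _≟_ v) (δ-≢ _≟_ (≢-sym (loopless e)))
    incident e (inj₂ refl) = cong₂ _+_ (δ-≢ _≟_ (loopless e)) (δ-≡ _≟_ v)
    nonincident : ∀ e → ¬ Incident G v e → δ _≟_ (proj₁ (ends e)) v + δ _≟_ (proj₂ (ends e)) v ≡ 0ℚ
    nonincident e ¬inc = cong₂ _+_ (δ-≢ _≟_ (¬inc ∘ inj₁)) (δ-≢ _≟_ (¬inc ∘ inj₂))
    go : ∀ {m} (f : Fin m → Fin size) → deg vs (weight id (ends ∘ f)) v ≡ fromℕ (count (incident? G v) (tabulate f))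
    go {zero}  f = trans (ℚ.+-identityʳ (∑ (λ (_ : Fin n) → 0ℚ) vs)) (∑-zero vs)
    go {suc m} f = begin
      deg vs (weight id (ends ∘ f)) v
        ≡⟨ deg-⊕ vs (link _≟_ a b) (weight id (ends ∘ f ∘ suc)) v ⟩
      deg vs (link _≟_ a b) v + deg vs (weight id (ends ∘ f ∘ suc)) v
        ≡⟨ cong₂ _+_ (deg-link (loopless (f zero)) v) (go (f ∘ suc)) ⟩
      δ _≟_ a v + δ _≟_ b v + fromℕ (count (incident? G v) (tabulate (f ∘ suc)))
        ≡⟨ count-∷ (incident? G v) (incident (f zero)) (nonincident (f zero)) (tabulate (f ∘ suc)) ⟨
      fromℕ (count (incident? G v) (tabulate f)) ∎
      where
      open ≡-Reasoning
      a = proj₁ (ends (f zero))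
      b = proj₂ (ends (f zero))

  τ≡treeSum : fromℕ (τ G) ≡ treeSum vs W
  τ≡treeSum = trans
    (cong (fromℕ ∘ length) (filter-≐ (isSpanningTree? G) (completes? id ends)
      ( (λ {S} → Equivalence.from (completes⇔spanningTree G S))
      , (λ {S} → Equivalence.to (completes⇔spanningTree G S))) (allSubsets size)))
    (count-completes size ends vs
      (record { unique = allFin⁺ n ; label∈ = ∈-allFin ; surjective = λ {v} _ → v , refl }))

  private
    Δ : ℕ
    Δ = maxMultiplicity G

  augmentedDet-τ : augmentedDet vs W (fromℕ Δ) (λ _ → 1ℚ) ≡ fromℕ (τ G ℕ.* (Δ ℕ.* n ℕ.^ 2))
  augmentedDet-τ = begin
    fromℕ Δ * (∑ (λ _ → 1ℚ) vs * ∑ (λ _ → 1ℚ) vs) * treeSum vs W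
      ≡⟨ cong₂ (λ k T → fromℕ Δ * (k * k) * T) ∑1 (sym τ≡treeSum) ⟩
    fromℕ Δ * (fromℕ n * fromℕ n) * fromℕ (τ G)
      ≡⟨ rearrange (fromℕ Δ) (fromℕ n) (fromℕ (τ G)) ⟩
    fromℕ (τ G) * (fromℕ Δ * (fromℕ n * (fromℕ n * 1ℚ)))
      ≡⟨ cong (λ x → fromℕ (τ G) * (fromℕ Δ * x)) (trans (fromℕ-* n (n ℕ.* 1)) (cong (fromℕ n *_) (fromℕ-* n 1))) ⟨
    fromℕ (τ G) * (fromℕ Δ * fromℕ (n ℕ.^ 2))
      ≡⟨ trans (fromℕ-* (τ G) (Δ ℕ.* n ℕ.^ 2)) (cong (fromℕ (τ G) *_) (fromℕ-* Δ (n ℕ.^ 2))) ⟨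
    fromℕ (τ G ℕ.* (Δ ℕ.* n ℕ.^ 2)) ∎
    where
    open ≡-Reasoning
    ∑1 : ∑ (λ _ → 1ℚ) vs ≡ fromℕ n
    ∑1 = trans (∑-one vs) (cong fromℕ {x = length vs} {y = n} (length-tabulate id))
    rearrange : ∀ Δ n τ → Δ * (n * n) * τ ≡ τ * (Δ * (n * (n * 1ℚ)))
    rearrange = solve-∀ ℚ-ring

  ∏-degrees : ∏ (diagonal vs W (fromℕ Δ) (λ _ → 1ℚ)) vs ≡ fromℕ (product (map (Δ ℕ.+_) (degreeSequence G)))
  ∏-degrees = begin
    ∏ (diagonal vs W (fromℕ Δ) (λ _ → 1ℚ)) vs
      ≡⟨ ∏-cong (All.universal entry vs) ⟩
    ∏ (λ v → fromℕ (Δ ℕ.+ degree G v)) vs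
      ≡⟨ fromℕ-product (λ v → Δ ℕ.+ degree G v) vs ⟨
    fromℕ (product (map (λ v → Δ ℕ.+ degree G v) vs))
      ≡⟨ cong (fromℕ ∘ product) (map-∘ {g = Δ ℕ.+_} {f = degree G} vs) ⟩
    fromℕ (product (map (Δ ℕ.+_) (map (degree G) vs)))
      ≡⟨ cong fromℕ (product-↭ (map⁺ (Δ ℕ.+_) (sort-↭ (map (degree G) vs)))) ⟨
    fromℕ (product (map (Δ ℕ.+_) (degreeSequence G))) ∎
    where
    open ≡-Reasoning
    swap-sum : ∀ a b → a + b * (1ℚ * 1ℚ) ≡ b + a
    swap-sum = solve-∀ ℚ-ring
    entry : ∀ v → diagonal vs W (fromℕ Δ) (λ _ → 1ℚ) v ≡ fromℕ (Δ ℕ.+ degree G v)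
    entry v = trans (cong (_+ fromℕ Δ * (1ℚ * 1ℚ)) (deg-weight v))
      (trans (swap-sum (fromℕ (degree G v)) (fromℕ Δ)) (sym (fromℕ-+ Δ (degree G v))))

  diagonal⇔complete : IsDiagonal vs W (fromℕ Δ) (λ _ → 1ℚ) ⇔ IsCompleteMultigraph G
  diagonal⇔complete = mk⇔ to from
    where
    Δ1 : fromℕ Δ * (1ℚ * 1ℚ) ≡ fromℕ Δ
    Δ1 = ℚ.*-identityʳ (fromℕ Δ)
    to : IsDiagonal vs W (fromℕ Δ) (λ _ → 1ℚ) → IsCompleteMultigraph G
    to diag u v u≢v = fromℕ-injective (trans (sym (weight-multiplicity u≢v)) (trans
      (allPairs⇒ (λ {i} {j} eq → trans (undirected (weight-isGraph id ends) j i) eq)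
        diag (∈-allFin u) (∈-allFin v) u≢v) Δ1))
    from : IsCompleteMultigraph G → IsDiagonal vs W (fromℕ Δ) (λ _ → 1ℚ)
    from complete = unique⇒allPairs (allFin⁺ n) λ {u} {v} _ _ u≢v →
      trans (weight-multiplicity u≢v) (trans (cong fromℕ (complete u v u≢v)) (sym Δ1))

-- Clearing denominators and conclusion

open import Data.Integer using (+_)

/1≡/⇔*≡ : ∀ a b d .{{_ : ℕ.NonZero d}} → ((+ a) / 1 ≡ (+ b) / d) ⇔ (a ℕ.* d ≡ b)
/1≡/⇔*≡ a b d@(suc d-1) = mk⇔ to from
  where
  open ≡-Reasoning
  to : (+ a) / 1 ≡ (+ b) / d → a ℕ.* d ≡ b
  to eq with ℚ.fromℚᵘ-injective {mkℚᵘ (+ a) 0} {mkℚᵘ (+ b) d-1} eq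
  ... | *≡* eq′ = ℤ.+-injective (trans (ℤ.pos-* a d) (trans eq′ (ℤ.*-identityʳ (+ b))))
  from : a ℕ.* d ≡ b → (+ a) / 1 ≡ (+ b) / d
  from eq = ℚ.fromℚᵘ-cong {mkℚᵘ (+ a) 0} {mkℚᵘ (+ b) d-1}
    (*≡* (trans (sym (ℤ.pos-* a d)) (trans (cong +_ eq) (sym (ℤ.*-identityʳ (+ b))))))

mainTheorem3 : (n : ℕ) (G : Multigraph n) (Δ≥1 : 1 ℕ.≤ maxMultiplicity G) →
    ((+ τ G) / 1 ≡ spanningTreeBound G Δ≥1) ⇔ IsCompleteMultigraph G
mainTheorem3 zero    G ()
mainTheorem3 (suc n) G Δ≥1 = mk⇔
  (λ eq → Equivalence.to (diagonal⇔complete G) (Equivalence.to tight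
    (trans (augmentedDet-τ G) (trans (cong fromℕ (Equivalence.to clear eq)) (sym (∏-degrees G))))))
  (λ complete → Equivalence.from clear (fromℕ-injective
    (trans (sym (augmentedDet-τ G)) (trans (Equivalence.from tight (Equivalence.from (diagonal⇔complete G) complete)) (∏-degrees G)))))
  where
  Δ = maxMultiplicity G
  W = weight id (Multigraph.ends G)
  clear = /1≡/⇔*≡ (τ G) (product (map (Δ ℕ.+_) (degreeSequence G))) (Δ ℕ.* suc n ℕ.^ 2) {{denominator≢0 G Δ≥1}}
  -- The list `zero ∷ tabulate suc` is `allFin (suc n)` by computation; the matrix is `L + ΔJ`, with
  -- `t = Δ` and `w` constantly 1.
  tight = proj₂ (hadamard zero (tabulate suc) {m = W} (weight-isGraph id (Multigraph.ends G)) (fromℕ-pos Δ≥1) (λ _ → ℚ.positive⁻¹ 1ℚ))
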